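{- For a nonnegative integer $n$, let $b_{21}(n)$ denote the number of $21$-regular partitions of $n$. Let $\beta\in\{8,37,66,95,124,153,182,211,240,269,298,327,356,414,443,472,501,530,559,588,617,646,675,704,733,762,791,820\}$. Then for all integers $n\geq 0$, $$b_{21}(4(29^2\cdot n+\beta)+1)\equiv 0\pmod 2.$$
   Context: For a positive integer $\ell$, an $\ell$-regular partition of $n$ is a partition of $n$ none of whose parts is divisible by $\ell$; $b_\ell(n)$ denotes the number of $\ell$-regular partitions of $n$, with $b_\ell(0)=1$. Equivalently, $\sum_{n=0}^{\infty}b_{\ell}(n)q^n=\prod_{j=1}^{\infty}\frac{1-q^{\ell j}}{1-q^{j}}$. -}

module Defs where

open import Data.List.Base using (List; []; _∷_; length; filter; upTo; cartesianProductWith)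
open import Data.List.Membership.Propositional using (_∈_)
open import Data.List.Membership.Propositional.Properties
  using (∈-filter⁺; ∈-filter⁻; ∈-cartesianProductWith⁺; ∈-cartesianProductWith⁻; ∈-upTo⁺)
open import Data.List.Properties using (∷-injective)
open import Data.List.Relation.Unary.All as All using (All; []; _∷_; all?)
open import Data.List.Relation.Unary.AllPairs.Core using ([]; _∷_)
open import Data.List.Relation.Unary.Any using (here; there)
open import Data.List.Relation.Unary.Linked using (Linked; linked?)
open import Data.List.Relation.Unary.Unique.Propositional using (Unique)
open import Data.List.Relation.Unary.Unique.Propositional.Properties
  using (filter⁺; cartesianProductWith⁺; upTo⁺)
open import Data.Nat.Base using (ℕ; zero; suc; _≤_; _<_; _≥_; z≤n; s≤s)
open import Data.Nat.Divisibility using (_∤_; _∣?_)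
open import Data.Nat.ListAction using (sum)
open import Data.Nat.Properties
  using (_≟_; _<?_; _≥?_; ≤-trans; +-mono-≤; m≤m+n; m≤n+m)
open import Data.Product.Base using (_,_; proj₂)
open import Function.Bundles using (_⇔_; mk⇔)
open import Relation.Binary.PropositionalEquality using (_≡_; refl)
open import Relation.Nullary.Decidable using (Dec; map′; _×-dec_; ¬?)

-- A partition is written as the weakly decreasing list of its parts.
record IsPartition (n : ℕ) (parts : List ℕ) : Set where
  constructor isPartition
  field
    positive   : All (0 <_) parts
    decreasing : Linked _≥_ parts
    total      : sum parts ≡ n

record IsRegularPartition (ℓ n : ℕ) (parts : List ℕ) : Set where
  constructor isRegularPartition
  field
    partition : IsPartition n parts
    regular   : All (ℓ ∤_) parts

isPartition? : ∀ n parts → Dec (IsPartition n parts)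
isPartition? n parts =
  map′ (λ (p , d , t) → isPartition p d t)
       (λ (isPartition p d t) → p , d , t)
       (all? (0 <?_) parts ×-dec linked? _≥?_ parts ×-dec (sum parts ≟ n))

isRegularPartition? : ∀ ℓ n parts → Dec (IsRegularPartition ℓ n parts)
isRegularPartition? ℓ n parts =
  map′ (λ (p , r) → isRegularPartition p r)
       (λ (isRegularPartition p r) → p , r)
       (isPartition? n parts ×-dec all? (λ p → ¬? (ℓ ∣? p)) parts)

-- All lists of length at most k with entries taken from xs.
listsUpTo : ℕ → List ℕ → List (List ℕ)
listsUpTo zero    xs = [] ∷ []
listsUpTo (suc k) xs = [] ∷ cartesianProductWith _∷_ xs (listsUpTo k xs)

-- A partition of n has at most n parts, each at most n, so searching the lists
-- of length at most n with entries in {0, …, n} misses none.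
regularPartitions : ℕ → ℕ → List (List ℕ)
regularPartitions ℓ n =
  filter (isRegularPartition? ℓ n) (listsUpTo n (upTo (suc n)))

b : ℕ → ℕ → ℕ
b ℓ n = length (regularPartitions ℓ n)

-- Together, regularPartitions-unique and ∈-regularPartitions say that
-- regularPartitions ℓ n lists every ℓ-regular partition of n exactly once.

listsUpTo-unique : ∀ k {xs} → Unique xs → Unique (listsUpTo k xs)
listsUpTo-unique zero    u = [] ∷ []
listsUpTo-unique (suc k) {xs} u =
  All.tabulate nonEmpty ∷ cartesianProductWith⁺ _∷_ ∷-injective u (listsUpTo-unique k u)
  where
  nonEmpty : ∀ {ys} → ys ∈ cartesianProductWith _∷_ xs (listsUpTo k xs) → [] ≡ ys → _
  nonEmpty ys∈ refl with ∈-cartesianProductWith⁻ _∷_ xs (listsUpTo k xs) ys∈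
  ... | _ , _ , _ , _ , ()

regularPartitions-unique : ∀ ℓ n → Unique (regularPartitions ℓ n)
regularPartitions-unique ℓ n =
  filter⁺ (isRegularPartition? ℓ n) (listsUpTo-unique n (upTo⁺ (suc n)))

∈-listsUpTo : ∀ k {xs ys} → length ys ≤ k → All (_∈ xs) ys → ys ∈ listsUpTo k xs
∈-listsUpTo zero    {ys = []}    _         _          = here refl
∈-listsUpTo (suc k) {ys = []}    _         _          = here refl
∈-listsUpTo (suc k) {ys = _ ∷ _} (s≤s len) (y∈ ∷ ys∈) =
  there (∈-cartesianProductWith⁺ _∷_ y∈ (∈-listsUpTo k len ys∈))

length≤sum : ∀ {parts} → All (0 <_) parts → length parts ≤ sum parts
length≤sum []       = z≤n
length≤sum (p ∷ ps) = +-mono-≤ p (length≤sum ps)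

parts≤sum : ∀ parts → All (_≤ sum parts) parts
parts≤sum []       = []
parts≤sum (p ∷ ps) =
  m≤m+n p (sum ps) ∷ All.map (λ q≤ → ≤-trans q≤ (m≤n+m (sum ps) p)) (parts≤sum ps)

∈-regularPartitions : ∀ ℓ n {parts} →
  parts ∈ regularPartitions ℓ n ⇔ IsRegularPartition ℓ n parts
∈-regularPartitions ℓ n {parts} = mk⇔
  (λ p∈ → proj₂ (∈-filter⁻ (isRegularPartition? ℓ n) {xs = listsUpTo n (upTo (suc n))} p∈))
  (λ r → ∈-filter⁺ (isRegularPartition? ℓ n) (candidate (IsRegularPartition.partition r)) r)
  where
  candidate : IsPartition n parts → parts ∈ listsUpTo n (upTo (suc n))
  candidate (isPartition pos _ refl) =
    ∈-listsUpTo n (length≤sum pos) (All.map (λ q≤ → ∈-upTo⁺ (s≤s q≤)) (parts≤sum parts))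

{-# OPTIONS --safe #-}
module Submission where

-- Work with power series modulo 2 and write f_k = ∏ (1 - q^(kj)). Since f₁⁴ ≡ f₁(q⁴), the relation
-- Σ b₂₁(n) qⁿ · f₁ = f₂₁ gives Σ c(n) qⁿ · f₁ ≡ U(f₁³ f₂₁), where c(n) = b₂₁(4n+1) and U selects the
-- exponents 4n+1. The pentagonal number theorem (Shanks's proof) turns such products into counts of
-- representations by binary quadratic forms modulo 2, which are evaluated by sign-changing
-- involutions after dividing by suitable elements of ℤ[√-2] and ℤ[√-7]:
-- f₁³ ≡ Σ q^(i(2i+1)), f₃³ ≡ f₁ Σ q^(l(3l+2)) and U(f₁³ f₂₁) ≡ f₁₂ ≡ f₃⁴, sums over ℤ.
-- Hence Σ c(n) qⁿ ≡ f₃ Σ q^(l(3l+2)), and c(n) counts the solutions of 3y² + 8k² = 24n + 11 with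
-- y ≡ 1 (mod 6) and k ≡ 1 (mod 3). When 29 divides 24n + 11 exactly once, multiplication by the
-- quotient of the two primes above 29 in ℚ(√-6) pairs these solutions off.

-- Each exponent fixes a sign: a pentagonal number contributes `6i + 1`, a triangular one `4i + 1`,
-- never the negative. Conjugation therefore does not act on the representations that a product of
-- such series counts. Division by `1 + √-2` of norm 3, or by `-3 + √-7` of norm 16, leads to
-- coordinates in which one sign can be changed within the congruence conditions. Modulo 2 only the
-- points where that coordinate is zero survive, and the binary form becomes a single square. Values
-- divisible by 3 admit no such fold; there the division merely lowers the value, whence a descent.
-- Every quotient is written as a polynomial that uses the equation in place of a denominator, so
-- that polynomial identities can certify it. The series for c is reached through f₁ c because f₁⁴,
-- being a series in q⁴, commutes with U, whereas f₁ does not. Afterwards f₁ can be cancelled, as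
-- its constant term is 1.

-- Parities of finite sets of solutions.

module Counting where

  open import Data.Empty using (⊥-elim)
  open import Data.Integer.Base as ℤ using (ℤ; 0ℤ)
  import Data.Integer.Properties as ℤ
  open import Data.List.Base using (List; []; _∷_; length; map; cartesianProduct)
  open import Data.List.Membership.Propositional using (_∈_)
  open import Data.List.Membership.Propositional.Properties
    using (∈-filter⁺; ∈-filter⁻; ∈-++⁺ˡ; ∈-++⁺ʳ; ∈-++⁻; ∈-cartesianProduct⁺; ∈-cartesianProduct⁻)
  open import Data.List.Membership.Propositional.Properties.WithK using (unique∧set⇒bag)
  open import Data.List.Properties using (length-++; length-map)
  open import Data.List.Relation.Binary.BagAndSetEquality using (∼bag⇒↭)
  open import Data.List.Relation.Binary.Permutation.Propositional.Properties using (↭-length)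
  open import Data.List.Relation.Unary.All as All using (All; []; _∷_)
  open import Data.List.Relation.Unary.AllPairs.Core using ([]; _∷_)
  open import Data.List.Relation.Unary.Any using (here; there)
  open import Data.List.Relation.Unary.Unique.Propositional using (Unique)
  import Data.List.Relation.Unary.Unique.Propositional.Properties as Unique
  open import Data.Nat.Base as ℕ using (parity)
  open import Data.Parity.Base using (Parity; 0ℙ; 1ℙ; _*_) renaming (_+_ to infixl 6 _+_)
  open import Data.Parity.Properties using (+-homo-+; *-homo-*; p+p≡0ℙ; +-identityʳ)
  open import Data.Product.Base using (∃; ∃-syntax; _×_; _,_; proj₁)
  open import Data.Sum.Base using (_⊎_; inj₁; inj₂; [_,_]′)
  open import Function.Base using (_∘_)
  open import Function.Bundles using (mk⇔)
  open import Relation.Binary.Definitions using (tri<; tri≈; tri>)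
  open import Relation.Binary.PropositionalEquality
    using (_≡_; refl; sym; trans; cong; cong₂; subst)
  open import Relation.Nullary using (¬_; yes; no)
  open import Relation.Unary using (Decidable)

  private
    variable
      A B : Set
      P Q R : A → Set
      p q : Parity

  -- The predicates live on infinite types such as ℤ × ℤ, so a list without repetitions witnesses
  -- finiteness; of its length only the parity is exposed in the type.
  record HasParity {A : Set} (P : A → Set) (p : Parity) : Set where
    constructor enumerated
    field
      {members} : List A
      unique    : Unique members
      sound     : ∀ {x} → x ∈ members → P x
      complete  : ∀ {x} → P x → x ∈ members
      size      : parity (length members) ≡ p

  open HasParity

  -- Two repetition-free lists with the same elements are permutations of each other. Congruences
  -- between coefficients come from here: one set is counted in two ways.
  parity-unique : HasParity P p → HasParity P q → p ≡ q
  parity-unique E F = trans (sym (size E)) (trans (cong parity same-length) (size F))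
    where
    same-length = ↭-length (∼bag⇒↭ (unique∧set⇒bag (unique E) (unique F)
      (mk⇔ (complete F ∘ sound E) (complete E ∘ sound F))))

  parity-empty : (∀ {x} → ¬ P x) → HasParity P 0ℙ
  parity-empty none = enumerated [] (λ ()) (⊥-elim ∘ none) refl

  parity-singleton : ∀ (a : A) → P a → (∀ {x} → P x → x ≡ a) → HasParity P 1ℙ
  parity-singleton a Pa only =
    enumerated ([] ∷ []) (λ { (here refl) → Pa }) (here ∘ only) refl

  parity-union : HasParity P p → HasParity Q q → (∀ {x} → P x → ¬ Q x) →
                 (∀ {x} → R x → P x ⊎ Q x) → (∀ {x} → P x → R x) → (∀ {x} → Q x → R x) →
                 HasParity R (p + q)
  parity-union E F disjoint split left right = enumerated
    (Unique.++⁺ (unique E) (unique F) (λ (x∈ , x∈′) → disjoint (sound E x∈) (sound F x∈′)))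
    ([ left ∘ sound E , right ∘ sound F ]′ ∘ ∈-++⁻ (members E))
    ([ ∈-++⁺ˡ ∘ complete E , ∈-++⁺ʳ (members E) ∘ complete F ]′ ∘ split)
    (trans (cong parity (length-++ (members E)))
      (trans (+-homo-+ (length (members E)) _) (cong₂ _+_ (size E) (size F))))

  length-cartesianProduct : (xs : List A) (ys : List B) →
                            length (cartesianProduct xs ys) ≡ length xs ℕ.* length ys
  length-cartesianProduct []       ys = refl
  length-cartesianProduct (x ∷ xs) ys = trans (length-++ (map (x ,_) ys))
    (cong₂ ℕ._+_ (length-map (x ,_) ys) (length-cartesianProduct xs ys))

  parity-product : HasParity P p → HasParity Q q →
                   HasParity (λ (x , y) → P x × Q y) (p * q)
  parity-product E F = enumerated
    (Unique.cartesianProduct⁺ (unique E) (unique F))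
    (λ xy∈ → let x∈ , y∈ = ∈-cartesianProduct⁻ (members E) (members F) xy∈
             in sound E x∈ , sound F y∈)
    (λ (x , y) → ∈-cartesianProduct⁺ (complete E x) (complete F y))
    (trans (cong parity (length-cartesianProduct (members E) (members F)))
      (trans (*-homo-* (length (members E)) _) (cong₂ _*_ (size E) (size F))))

  parity-filter : ∀ {D : A → Set} → Decidable D → HasParity P p →
                  ∃ (HasParity (λ x → P x × D x))
  parity-filter D? E = _ , enumerated
    (Unique.filter⁺ D? (unique E))
    (λ x∈ → let x∈′ , Dx = ∈-filter⁻ D? {xs = members E} x∈ in sound E x∈′ , Dx)
    (λ (Px , Dx) → ∈-filter⁺ D? (complete E Px) Dx)
    refl

  -- A relation instead of a function, because an image may be found from the proof of `P x`, for
  -- instance through a sign or a residue class; uniqueness is asked for only on the two sets.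
  record Correspondence {A B : Set} (P : A → Set) (Q : B → Set) : Set₁ where
    field
      Related    : A → B → Set
      to         : ∀ {x} → P x → ∃ λ y → Q y × Related x y
      from       : ∀ {y} → Q y → ∃ λ x → P x × Related x y
      injective  : ∀ {x x′ y} → P x → P x′ → Related x y → Related x′ y → x ≡ x′
      functional : ∀ {x y y′} → Q y → Q y′ → Related x y → Related x y′ → y ≡ y′

  module _ {A B : Set} {P : A → Set} {Q : B → Set} (C : Correspondence P Q) where
    open Correspondence C

    private
      images : ∀ {xs} → All P xs → List B
      images []         = []
      images (Px ∷ Pxs) = proj₁ (to Px) ∷ images Pxs

      length-images : ∀ {xs} (Pxs : All P xs) → length (images Pxs) ≡ length xs
      length-images []         = refl
      length-images (Px ∷ Pxs) = cong ℕ.suc (length-images Pxs)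

      images-sound : ∀ {xs y} (Pxs : All P xs) → y ∈ images Pxs →
                     Q y × ∃ λ x → x ∈ xs × Related x y
      images-sound (Px ∷ Pxs) (here refl) with _ , Qy , r ← to Px = Qy , _ , here refl , r
      images-sound (Px ∷ Pxs) (there y∈)
        with Qy , x , x∈ , r ← images-sound Pxs y∈ = Qy , x , there x∈ , r

      images-complete : ∀ {xs x y} (Pxs : All P xs) → x ∈ xs → Q y → Related x y → y ∈ images Pxs
      images-complete (Px ∷ Pxs) (here refl) Qy r
        with _ , Qy′ , r′ ← to Px = here (functional Qy Qy′ r r′)
      images-complete (Px ∷ Pxs) (there x∈) Qy r = there (images-complete Pxs x∈ Qy r)

      images-unique : ∀ {xs} (Pxs : All P xs) → Unique xs → Unique (images Pxs)
      images-unique []         []       = []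
      images-unique (Px ∷ Pxs) (x≢ ∷ u) = All.tabulate fresh ∷ images-unique Pxs u
        where
        fresh : ∀ {y} → y ∈ images Pxs → ¬ proj₁ (to Px) ≡ y
        fresh y∈ refl with _ , _ , r ← to Px | _ , x , x∈ , r′ ← images-sound Pxs y∈ =
          All.lookup x≢ x∈ (injective Px (All.lookup Pxs x∈) r r′)

    transport : HasParity P p → HasParity Q p
    transport E = enumerated
      (images-unique Pxs (unique E))
      (proj₁ ∘ images-sound Pxs)
      (λ Qy → let x , Px , r = from Qy in images-complete Pxs (complete E Px) Qy r)
      (trans (cong parity (length-images Pxs)) (size E))
      where Pxs = All.tabulate (sound E)

  module _ {A B : Set} {P : A → Set} {Q : B → Set} (φ : B → A)
           (injective : ∀ {y y′} → Q y → Q y′ → φ y ≡ φ y′ → y ≡ y′)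
           (to : ∀ {y} → Q y → P (φ y))
           (onto : ∀ {x} → P x → ∃[ y ] Q y × φ y ≡ x) where

    pullback : HasParity P p → HasParity Q p
    pullback = transport (record
      { Related    = λ x y → φ y ≡ x
      ; to         = onto
      ; from       = λ Qy → _ , to Qy , refl
      ; injective  = λ { _ _ refl refl → refl }
      ; functional = λ Qy Qy′ r r′ → injective Qy Qy′ (trans r (sym r′))
      })

    pushforward : HasParity Q p → HasParity P p
    pushforward = transport (record
      { Related    = λ y x → φ y ≡ x
      ; to         = λ Qy → _ , to Qy , refl
      ; from       = onto
      ; injective  = λ Qy Qy′ r r′ → injective Qy Qy′ (trans r (sym r′))
      ; functional = λ { _ _ refl refl → refl }
      })

  parity-none : (∀ {x} → ¬ P x) → (∀ {y} → ¬ Q y) → HasParity P p → HasParity Q p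
  parity-none noP noQ E = subst (HasParity _) (parity-unique (parity-empty noP) E) (parity-empty noQ)

  -- The maps are mutually inverse on the two sets only. Thus `ρ` may be a polynomial that agrees
  -- with a division by 3 just where the defining equation holds.
  parity-substitute : (φ : B → A) (ρ : A → B) →
                      (∀ {x} → P x → φ (ρ x) ≡ x) → (∀ {y} → Q y → ρ (φ y) ≡ y) →
                      (∀ {y} → Q y → P (φ y)) → (∀ {y} → P (φ y) → Q y) →
                      HasParity P p → HasParity Q p
  parity-substitute {P = P} φ ρ φρ ρφ to from = pullback φ
    (λ Qy Qy′ e → trans (sym (ρφ Qy)) (trans (cong ρ e) (ρφ Qy′)))
    to
    (λ Px → _ , from (subst P (sym (φρ Px)) Px) , φρ Px)

  parity-cong : (∀ {x} → P x → Q x) → (∀ {x} → Q x → P x) → HasParity P p → HasParity Q p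
  parity-cong to from E =
    enumerated (unique E) (to ∘ sound E) (complete E ∘ from) (size E)

  -- The elements with s x ≢ 0 cancel in pairs, σ exchanging s x > 0 and s x < 0.
  parity-fold : (σ : A → A) (s : A → ℤ) → (∀ x → σ (σ x) ≡ x) → (∀ x → s (σ x) ≡ ℤ.- s x) →
                (∀ {x} → P x → P (σ x)) → HasParity P p → HasParity (λ x → P x × s x ≡ 0ℤ) p
  parity-fold {A = A} {P = P} {p = p} σ s σσ sσ Pσ E
    with z , Z ← parity-filter {D = λ x → s x ≡ 0ℤ} (λ x → s x ℤ.≟ 0ℤ) E
       | n , N ← parity-filter {D = λ x → 0ℤ ℤ.< s x} (λ x → 0ℤ ℤ.<? s x) E =
    subst (HasParity _) (trans (sym (+-identityʳ z)) (parity-unique whole E)) Z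
    where
    negatives : HasParity (λ x → P x × s x ℤ.< 0ℤ) n
    negatives = transport (record
      { Related    = λ x y → y ≡ σ x
      ; to         = λ (Px , s>0) → _ , (Pσ Px , subst (ℤ._< 0ℤ) (sym (sσ _)) (ℤ.neg-mono-< s>0)) , refl
      ; from       = λ (Py , s<0) → _ , (Pσ Py , subst (0ℤ ℤ.<_) (sym (sσ _)) (ℤ.neg-mono-< s<0)) , sym (σσ _)
      ; injective  = λ { _ _ refl e → trans (sym (σσ _)) (trans (cong σ e) (σσ _)) }
      ; functional = λ { _ _ refl refl → refl }
      }) N

    nonzero : HasParity (λ x → P x × ¬ s x ≡ 0ℤ) (n + n)
    nonzero = parity-union N negatives
      (λ (_ , s>0) (_ , s<0) → ℤ.<-asym s>0 s<0)
      split
      (λ (Px , s>0) → Px , λ s≡0 → ℤ.<-irrefl (sym s≡0) s>0)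
      (λ (Px , s<0) → Px , λ s≡0 → ℤ.<-irrefl s≡0 s<0)
      where
      split : ∀ {x} → P x × ¬ s x ≡ 0ℤ → (P x × 0ℤ ℤ.< s x) ⊎ (P x × s x ℤ.< 0ℤ)
      split {x} (Px , s≢0) with ℤ.<-cmp (s x) 0ℤ
      ... | tri< s<0 _ _ = inj₂ (Px , s<0)
      ... | tri≈ _ s≡0 _ = ⊥-elim (s≢0 s≡0)
      ... | tri> _ _ s>0 = inj₁ (Px , s>0)

    whole : HasParity P (z + 0ℙ)
    whole = subst (λ q → HasParity P (z + q)) (p+p≡0ℙ n)
      (parity-union Z nonzero (λ (_ , s≡0) (_ , s≢0) → s≢0 s≡0) split proj₁ proj₁)
      where
      split : ∀ {x} → P x → (P x × s x ≡ 0ℤ) ⊎ (P x × ¬ s x ≡ 0ℤ)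
      split {x} Px with s x ℤ.≟ 0ℤ
      ... | yes s≡0 = inj₁ (Px , s≡0)
      ... | no  s≢0 = inj₂ (Px , s≢0)

-- Power series with coefficients modulo 2.

module Series where

  open import Algebra.Bundles using (CommutativeRing)
  import Algebra.Solver.Ring
  import Algebra.Solver.Ring.AlmostCommutativeRing as ACR
  open ACR using (_-Raw-AlmostCommutative⟶_)
  open import Data.Maybe.Base as Maybe using (nothing)
  open import Data.Nat.Base as ℕ using (ℕ; zero; suc; _≤_; _<_; z≤n; s≤s)
  import Data.Nat.Properties as ℕ
  open import Data.Parity.Base using (Parity; 0ℙ; 1ℙ; _*_) renaming (_+_ to infixl 6 _+_)
  import Data.Parity.Properties as ℙ
  open import Data.Product.Base using (_,_)
  open import Function.Base using (id; _∘_)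
  open import Level using (0ℓ)
  open import Relation.Binary.Definitions using (WeaklyDecidable)
  open import Relation.Binary.PropositionalEquality
    using (_≡_; refl; sym; trans; cong; cong₂; module ≡-Reasoning)
  open import Relation.Nullary using (¬_; contradiction)
  open import Relation.Nullary.Decidable using (dec⇒maybe)
  open import Tactic.RingSolver using (solve-∀)
  open import Tactic.RingSolver.Core.AlmostCommutativeRing
    using (AlmostCommutativeRing; fromCommutativeRing)

  parityRing : AlmostCommutativeRing 0ℓ 0ℓ
  parityRing = fromCommutativeRing ℙ.+-*-commutativeRing (λ _ → nothing)

  infix  4 _≈_
  infixl 6 _⊕_
  infixl 7 _⊛_

  Series : Set
  Series = ℕ → Parity

  _≈_ : Series → Series → Set
  f ≈ g = ∀ n → f n ≡ g n

  tail : Series → Series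
  tail f n = f (suc n)

  _⊕_ : Series → Series → Series
  (f ⊕ g) n = f n + g n

  _⊛_ : Series → Series → Series
  (f ⊛ g) zero    = f 0 * g 0
  (f ⊛ g) (suc n) = f 0 * g (suc n) + (tail f ⊛ g) n

  0S 1S : Series
  0S _ = 0ℙ
  1S zero    = 1ℙ
  1S (suc _) = 0ℙ

  private
    interchange : ∀ a b c d → (a + b) + (c + d) ≡ (a + c) + (b + d)
    interchange = solve-∀ parityRing

  -- Coefficient n of a product sees degrees up to n only, so truncations that are exact in that
  -- range may replace the factors.
  ⊛-cong-≤ : ∀ {f f′ g g′} n → (∀ {m} → m ≤ n → f m ≡ f′ m) → (∀ {m} → m ≤ n → g m ≡ g′ m) →
             (f ⊛ g) n ≡ (f′ ⊛ g′) n
  ⊛-cong-≤ zero    f≈ g≈ = cong₂ _*_ (f≈ z≤n) (g≈ z≤n)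
  ⊛-cong-≤ (suc n) f≈ g≈ = cong₂ _+_ (cong₂ _*_ (f≈ z≤n) (g≈ ℕ.≤-refl))
    (⊛-cong-≤ n (f≈ ∘ s≤s) (g≈ ∘ ℕ.m≤n⇒m≤1+n))

  ⊛-cong : ∀ {f f′ g g′} → f ≈ f′ → g ≈ g′ → f ⊛ g ≈ f′ ⊛ g′
  ⊛-cong f≈ g≈ n = ⊛-cong-≤ n (λ _ → f≈ _) (λ _ → g≈ _)

  ⊛-distribʳ : ∀ h f g → (f ⊕ g) ⊛ h ≈ f ⊛ h ⊕ g ⊛ h
  ⊛-distribʳ h f g zero    = ℙ.*-distribʳ-+ (h 0) (f 0) (g 0)
  ⊛-distribʳ h f g (suc n) = trans
    (cong₂ _+_ (ℙ.*-distribʳ-+ (h (suc n)) (f 0) (g 0)) (⊛-distribʳ h (tail f) (tail g) n))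
    (interchange (f 0 * h (suc n)) _ _ _)

  ⊛-scale : ∀ c f g → (λ n → c * f n) ⊛ g ≈ λ n → c * (f ⊛ g) n
  ⊛-scale c f g zero    = ℙ.*-assoc c (f 0) (g 0)
  ⊛-scale c f g (suc n) = trans
    (cong₂ _+_ (ℙ.*-assoc c (f 0) (g (suc n))) (⊛-scale c (tail f) g n))
    (sym (ℙ.*-distribˡ-+ c _ _))

  ⊛-zeroˡ : ∀ f → 0S ⊛ f ≈ 0S
  ⊛-zeroˡ f zero    = refl
  ⊛-zeroˡ f (suc n) = ⊛-zeroˡ f n

  ⊛-unfoldʳ : ∀ f g n → (f ⊛ g) (suc n) ≡ (f ⊛ tail g) n + f (suc n) * g 0
  ⊛-unfoldʳ f g zero    = refl
  ⊛-unfoldʳ f g (suc n) = trans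
    (cong (f 0 * g (suc (suc n)) +_) (⊛-unfoldʳ (tail f) g n))
    (sym (ℙ.+-assoc (f 0 * g (suc (suc n))) _ _))

  ⊛-comm : ∀ f g → f ⊛ g ≈ g ⊛ f
  ⊛-comm f g zero    = ℙ.*-comm (f 0) (g 0)
  ⊛-comm f g (suc n) = begin
    f 0 * g (suc n) + (tail f ⊛ g) n ≡⟨ cong₂ _+_ (ℙ.*-comm (f 0) _) (⊛-comm (tail f) g n) ⟩
    g (suc n) * f 0 + (g ⊛ tail f) n ≡⟨ ℙ.+-comm (g (suc n) * f 0) _ ⟩
    (g ⊛ tail f) n + g (suc n) * f 0 ≡⟨ ⊛-unfoldʳ g f n ⟨
    (g ⊛ f) (suc n)                  ∎
    where open ≡-Reasoning

  ⊛-assoc : ∀ f g h → (f ⊛ g) ⊛ h ≈ f ⊛ (g ⊛ h)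
  ⊛-assoc f g h zero    = ℙ.*-assoc (f 0) (g 0) (h 0)
  ⊛-assoc f g h (suc n) = begin
    f 0 * g 0 * h (suc n) + (((λ m → f 0 * tail g m) ⊕ tail f ⊛ g) ⊛ h) n
      ≡⟨ cong (f 0 * g 0 * h (suc n) +_) (⊛-distribʳ h (λ m → f 0 * tail g m) (tail f ⊛ g) n) ⟩
    f 0 * g 0 * h (suc n) + (((λ m → f 0 * tail g m) ⊛ h) n + ((tail f ⊛ g) ⊛ h) n)
      ≡⟨ cong (f 0 * g 0 * h (suc n) +_)
           (cong₂ _+_ (⊛-scale (f 0) (tail g) h n) (⊛-assoc (tail f) g h n)) ⟩
    f 0 * g 0 * h (suc n) + (f 0 * (tail g ⊛ h) n + (tail f ⊛ (g ⊛ h)) n)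
      ≡⟨ regroup (f 0) (g 0) (h (suc n)) _ _ ⟩
    f 0 * (g 0 * h (suc n) + (tail g ⊛ h) n) + (tail f ⊛ (g ⊛ h)) n ∎
    where
    open ≡-Reasoning
    regroup : ∀ a b c d e → a * b * c + (a * d + e) ≡ a * (b * c + d) + e
    regroup = solve-∀ parityRing

  ⊛-identityˡ : ∀ f → 1S ⊛ f ≈ f
  ⊛-identityˡ f zero    = refl
  ⊛-identityˡ f (suc n) = trans (cong (f (suc n) +_) (⊛-zeroˡ f n)) (ℙ.+-identityʳ _)

  seriesRing : CommutativeRing 0ℓ 0ℓ
  seriesRing = record
    { Carrier = Series ; _≈_ = _≈_ ; _+_ = _⊕_ ; _*_ = _⊛_ ; -_ = id ; 0# = 0S ; 1# = 1S
    ; isCommutativeRing = record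
      { isRing = record
        { +-isAbelianGroup = record
          { isGroup = record
            { isMonoid = record
              { isSemigroup = record
                { isMagma = record
                  { isEquivalence = record
                    { refl  = λ _ → refl
                    ; sym   = λ f≈g n → sym (f≈g n)
                    ; trans = λ f≈g g≈h n → trans (f≈g n) (g≈h n)
                    }
                  ; ∙-cong = λ f≈ g≈ n → cong₂ _+_ (f≈ n) (g≈ n)
                  }
                ; assoc = λ f g h n → ℙ.+-assoc (f n) (g n) (h n)
                }
              ; identity = (λ _ _ → refl) , λ f n → ℙ.+-identityʳ (f n)
              }
            ; inverse = (λ f n → ℙ.p+p≡0ℙ (f n)) , λ f n → ℙ.p+p≡0ℙ (f n)
            ; ⁻¹-cong = id
            }
          ; comm = λ f g n → ℙ.+-comm (f n) (g n)
          }
        ; *-cong = ⊛-cong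
        ; *-assoc = ⊛-assoc
        ; *-identity = ⊛-identityˡ , λ f n → trans (⊛-comm f 1S n) (⊛-identityˡ f n)
        ; distrib = (λ h f g n → trans (⊛-comm h (f ⊕ g) n) (trans (⊛-distribʳ h f g n)
                      (cong₂ _+_ (⊛-comm f h n) (⊛-comm g h n)))) , ⊛-distribʳ
        }
      ; *-comm = ⊛-comm
      }
    }

  -- Coefficients in Parity make the solver aware that the characteristic is 2.
  constants : CommutativeRing.rawRing ℙ.+-*-commutativeRing -Raw-AlmostCommutative⟶
              ACR.fromCommutativeRing seriesRing
  constants = record
    { ⟦_⟧    = constant
    ; +-homo = λ { 0ℙ q n → refl ; 1ℙ 0ℙ n → sym (ℙ.+-identityʳ (1S n)) ; 1ℙ 1ℙ n → sym (ℙ.p+p≡0ℙ (1S n)) }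
    ; *-homo = λ { 0ℙ q n → sym (⊛-zeroˡ (constant q) n) ; 1ℙ q n → sym (⊛-identityˡ (constant q) n) }
    ; -‿homo = λ _ _ → refl
    ; 0-homo = λ _ → refl
    ; 1-homo = λ _ → refl
    }
    where
    constant : Parity → Series
    constant 0ℙ = 0S
    constant 1ℙ = 1S

  _≟-constant_ : WeaklyDecidable (ACR.Induced-equivalence constants)
  p ≟-constant q = Maybe.map (λ { refl _ → refl }) (dec⇒maybe (p ℙ.≟ q))

  module Solver = Algebra.Solver.Ring _ _ constants _≟-constant_

  -- The difference d, which is `f ⊕ g` modulo 2, satisfies d h = 0. Its head vanishes because h
  -- starts with 1, and then its tail satisfies the same equation.
  ⊛-cancelʳ : ∀ {f g} h → h 0 ≡ 1ℙ → f ⊛ h ≈ g ⊛ h → f ≈ g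
  ⊛-cancelʳ {f} {g} h h₀ eq n = ℙ.+-cancelʳ-≡ (g n) (f n) (g n)
    (trans (vanish (f ⊕ g) product n) (sym (ℙ.p+p≡0ℙ (g n))))
    where
    product : (f ⊕ g) ⊛ h ≈ 0S
    product n = trans (⊛-distribʳ h f g n) (trans (cong (_+ (g ⊛ h) n) (eq n)) (ℙ.p+p≡0ℙ ((g ⊛ h) n)))

    vanish : ∀ d → d ⊛ h ≈ 0S → d ≈ 0S
    head-vanishes : ∀ d → d ⊛ h ≈ 0S → d 0 ≡ 0ℙ
    head-vanishes d eq = trans (sym (ℙ.*-identityʳ (d 0))) (trans (cong (d 0 *_) (sym h₀)) (eq 0))
    vanish d eq zero    = head-vanishes d eq
    vanish d eq (suc n) = vanish (tail d) (λ m → trans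
      (cong (λ c → c * h (suc m) + (tail d ⊛ h) m) (sym (head-vanishes d eq))) (eq (suc m))) n

  mono : ℕ → Series
  mono zero    = 1S
  mono (suc k) zero    = 0ℙ
  mono (suc k) (suc n) = mono k n

  mono-⊛-+ : ∀ k f n → (mono k ⊛ f) (k ℕ.+ n) ≡ f n
  mono-⊛-+ zero    f n = ⊛-identityˡ f n
  mono-⊛-+ (suc k) f n = mono-⊛-+ k f n

  mono-⊛-< : ∀ k f n → n < k → (mono k ⊛ f) n ≡ 0ℙ
  mono-⊛-< (suc k) f zero    _         = refl
  mono-⊛-< (suc k) f (suc n) (s≤s n<k) = mono-⊛-< k f n n<k

  mono-+ : ∀ j k → mono (j ℕ.+ k) ≈ mono j ⊛ mono k
  mono-+ zero    k n       = sym (⊛-identityˡ (mono k) n)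
  mono-+ (suc j) k zero    = refl
  mono-+ (suc j) k (suc n) = mono-+ j k n

  mono-diagonal : ∀ k → mono k k ≡ 1ℙ
  mono-diagonal zero    = refl
  mono-diagonal (suc k) = mono-diagonal k

  mono-off-diagonal : ∀ k n → ¬ k ≡ n → mono k n ≡ 0ℙ
  mono-off-diagonal zero    zero    k≢n = contradiction refl k≢n
  mono-off-diagonal zero    (suc n) k≢n = refl
  mono-off-diagonal (suc k) zero    k≢n = refl
  mono-off-diagonal (suc k) (suc n) k≢n = mono-off-diagonal k n (k≢n ∘ cong suc)

-- The pentagonal number theorem modulo 2 in the variable `q^s`.

module Pentagonal where

  open import Algebra.Bundles using (CommutativeRing)
  open Counting
  open import Data.Integer.Base using (ℤ; +_; -[1+_]; ∣_∣)
  open import Data.Nat.Base using (ℕ; zero; suc; _+_; _*_; _≤_; _<_; z≤n; s≤s)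
  import Data.Nat.Properties as ℕ
  open import Data.Nat.Tactic.RingSolver using () renaming (solve-∀ to solve-ℕ)
  open import Data.Parity.Base as ℙ using (0ℙ; 1ℙ)
  import Data.Parity.Properties as ℙ
  open import Data.Product.Base using (_×_; _,_; proj₁; proj₂)
  open import Data.Sum.Base using (inj₁; inj₂; [_,_]′)
  open import Function.Base using (_∘_)
  open import Relation.Binary.PropositionalEquality
    using (_≡_; refl; sym; trans; cong; cong₂; subst)
  open import Relation.Nullary using (yes; no)
  open Series
  open Solver using (solve; _:+_; _:*_; _:=_; con)

  triangular : ℕ → ℕ
  triangular zero    = 0
  triangular (suc n) = suc n + triangular n

  -- i(3i+1)/2
  pentagonal : ℤ → ℕ
  pentagonal (+ n)    = n * n + triangular n
  pentagonal -[1+ n ] = suc n * suc n + triangular n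

  ∣i∣≤pentagonal : ∀ i → ∣ i ∣ ≤ pentagonal i
  ∣i∣≤pentagonal (+ n)    = ℕ.≤-trans (n≤n*n n) (ℕ.m≤m+n _ _)
    where
    n≤n*n : ∀ n → n ≤ n * n
    n≤n*n zero    = z≤n
    n≤n*n (suc n) = ℕ.m≤m+n (suc n) _
  ∣i∣≤pentagonal -[1+ n ] = ℕ.≤-trans (ℕ.m≤m+n (suc n) _) (ℕ.m≤m+n _ _)

  parity-mono : ∀ {A : Set} (a : A) k n → HasParity (λ x → x ≡ a × k ≡ n) (mono k n)
  parity-mono a k n with k ℕ.≟ n
  ... | yes refl = subst (HasParity _) (sym (mono-diagonal k))
                     (parity-singleton a (refl , refl) proj₁)
  ... | no  k≢n  = subst (HasParity _) (sym (mono-off-diagonal k n k≢n))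
                     (parity-empty (k≢n ∘ proj₂))

  module _ (s : ℕ) where

    q : ℕ → Series
    q k = mono (s * k)

    factor : ℕ → Series
    factor k = 1S ⊕ q k

    -- ratio a d is (1 + x^(a+1)) ⋯ (1 + x^(a+d)), where x = q 1.
    ratio : ℕ → ℕ → Series
    ratio a zero    = 1S
    ratio a (suc d) = factor (suc (a + d)) ⊛ ratio a d

    private
      module R = CommutativeRing seriesRing
      open import Relation.Binary.Reasoning.Setoid R.setoid

      q-cong : ∀ {j k} → j ≡ k → q j ≈ q k
      q-cong j≡k n = cong (λ i → q i n) j≡k

      q-+ : ∀ j k → q (j + k) ≈ q j ⊛ q k
      q-+ j k = R.trans (λ n → cong (λ i → mono i n) (ℕ.*-distribˡ-+ s j k)) (mono-+ (s * j) (s * k))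

      -- The definition of `ratio` adds the top factor; the comparison of neighbouring summands in
      -- Shanks's sum removes the bottom one.
      ratio-unfoldˡ : ∀ a d → ratio a (suc d) ≈ factor (suc a) ⊛ ratio (suc a) d
      ratio-unfoldˡ a zero n = cong (λ i → (factor (suc i) ⊛ 1S) n) (ℕ.+-identityʳ a)
      ratio-unfoldˡ a (suc d) = begin
        factor (suc (a + suc d)) ⊛ ratio a (suc d)
          ≈⟨ R.*-cong (λ n → cong (λ i → factor (suc i) n) (ℕ.+-suc a d)) (ratio-unfoldˡ a d) ⟩
        factor (suc (suc a + d)) ⊛ (factor (suc a) ⊛ ratio (suc a) d)
          ≈⟨ swap _ _ _ ⟩
        factor (suc a) ⊛ (factor (suc (suc a + d)) ⊛ ratio (suc a) d) ∎
        where
        swap : ∀ x y z → x ⊛ (y ⊛ z) ≈ y ⊛ (x ⊛ z)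
        swap = solve 3 (λ x y z → x :* (y :* z) := y :* (x :* z)) R.refl

      weight : ℕ → ℕ → ℕ
      weight a d = a * (a + d) + triangular a

      term : ℕ → ℕ → Series
      term a d = ratio a d ⊛ q (weight a d)

      -- Shanks's sum Σ_{a ≤ s ≤ a+d} (1 + x^(s+1))⋯(1 + x^n) x^(s n + s(s+1)/2) with n = a + d.
      shanks : ℕ → ℕ → Series
      shanks a zero    = term a 0
      shanks a (suc d) = term a (suc d) ⊕ shanks (suc a) d

      pair : ℕ → Series
      pair n = q (pentagonal -[1+ n ]) ⊕ q (pentagonal (+ suc n))

      -- With n = a + d + 1, raising the upper limit to n multiplies a summand by `(1 + x^n) x^a`.
      -- The change is split into two remainders, the two ends of a telescope.
      term-step : ∀ a d → term a (suc d) ⊕ term a d ≈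
                  term a d ⊛ factor a ⊕ term a d ⊛ q (suc (a + d) + a)
      term-step a d = begin
        factor n ⊛ ratio a d ⊛ q (weight a (suc d)) ⊕ t
          ≈⟨ R.+-congʳ {t} (R.*-congˡ {factor n ⊛ ratio a d} (R.trans (q-cong exponent) (q-+ _ a))) ⟩
        factor n ⊛ ratio a d ⊛ (q (weight a d) ⊛ q a) ⊕ t
          ≈⟨ solve 4 (λ n r w a → (con 1ℙ :+ n) :* r :* (w :* a) :+ r :* w :=
                                  r :* w :* (con 1ℙ :+ a) :+ r :* w :* (n :* a)) R.refl
               (q n) (ratio a d) (q (weight a d)) (q a) ⟩
        t ⊛ factor a ⊕ t ⊛ (q n ⊛ q a)
          ≈⟨ R.+-congˡ {t ⊛ factor a} (R.*-congˡ {t} (R.sym (q-+ n a))) ⟩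
        t ⊛ factor a ⊕ t ⊛ q (n + a) ∎
        where
        t = term a d
        n = suc (a + d)
        exponent : weight a (suc d) ≡ weight a d + a
        exponent = lemma a d (triangular a)
          where
          lemma : ∀ a d t → a * (a + suc d) + t ≡ a * (a + d) + t + a
          lemma = solve-ℕ

      -- The first remainder at a + 1 equals the second remainder at a, so the two cancel modulo 2.
      term-shift : ∀ a d → term (suc a) d ⊛ factor (suc a) ≈
                   term a (suc d) ⊛ q (suc (a + suc d) + a)
      term-shift a d = begin
        ratio (suc a) d ⊛ q (weight (suc a) d) ⊛ factor (suc a)
          ≈⟨ regroup _ _ _ ⟩
        factor (suc a) ⊛ ratio (suc a) d ⊛ q (weight (suc a) d)
          ≈⟨ R.*-cong (R.sym (ratio-unfoldˡ a d)) (R.trans (q-cong exponent) (q-+ (weight a (suc d)) _)) ⟩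
        ratio a (suc d) ⊛ (q (weight a (suc d)) ⊛ q (suc (a + suc d) + a))
          ≈⟨ R.*-assoc _ _ _ ⟨
        term a (suc d) ⊛ q (suc (a + suc d) + a) ∎
        where
        exponent : weight (suc a) d ≡ weight a (suc d) + (suc (a + suc d) + a)
        exponent = lemma a d (triangular a)
          where
          lemma : ∀ a d t → suc a * (suc a + d) + (suc a + t) ≡ a * (a + suc d) + t + (suc (a + suc d) + a)
          lemma = solve-ℕ
        regroup : ∀ r w f → r ⊛ w ⊛ f ≈ f ⊛ r ⊛ w
        regroup = solve 3 (λ r w f → r :* w :* f := f :* r :* w) R.refl

      -- All inner remainders cancel. The lower end keeps `factor a`; at the upper end the last
      -- remainder and the one additional summand are the two new pentagonal terms.
      shanks-step : ∀ a d → shanks a (suc d) ⊕ shanks a d ≈ term a d ⊛ factor a ⊕ pair (a + d)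
      shanks-step a zero = begin
        term a 1 ⊕ term (suc a) 0 ⊕ term a 0
          ≈⟨ swap (term a 1) (term (suc a) 0) (term a 0) ⟩
        term a 1 ⊕ term a 0 ⊕ term (suc a) 0
          ≈⟨ R.+-congʳ (term-step a 0) ⟩
        term a 0 ⊛ factor a ⊕ term a 0 ⊛ q (suc (a + 0) + a) ⊕ term (suc a) 0
          ≈⟨ R.+-assoc (term a 0 ⊛ factor a) _ _ ⟩
        term a 0 ⊛ factor a ⊕ (term a 0 ⊛ q (suc (a + 0) + a) ⊕ term (suc a) 0)
          ≈⟨ R.+-congˡ {term a 0 ⊛ factor a} (R.+-cong first second) ⟩
        term a 0 ⊛ factor a ⊕ pair (a + 0) ∎
        where
        swap : ∀ x y z → x ⊕ y ⊕ z ≈ x ⊕ z ⊕ y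
        swap = solve 3 (λ x y z → x :+ y :+ z := x :+ z :+ y) R.refl
        first : term a 0 ⊛ q (suc (a + 0) + a) ≈ q (suc (a + 0) * suc (a + 0) + triangular (a + 0))
        first = R.trans (R.*-congʳ (R.*-identityˡ (q (weight a 0))))
          (R.trans (R.sym (q-+ (weight a 0) _)) (q-cong exponent))
          where
          lemma : ∀ a t → a * a + t + (suc a + a) ≡ suc a * suc a + t
          lemma = solve-ℕ
          exponent : weight a 0 + (suc (a + 0) + a) ≡ suc (a + 0) * suc (a + 0) + triangular (a + 0)
          exponent rewrite ℕ.+-identityʳ a = lemma a (triangular a)
        second : term (suc a) 0 ≈ q (suc (a + 0) * suc (a + 0) + triangular (suc (a + 0)))
        second = R.trans (R.*-identityˡ (q (weight (suc a) 0))) (q-cong exponent)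
          where
          exponent : weight (suc a) 0 ≡ suc (a + 0) * suc (a + 0) + triangular (suc (a + 0))
          exponent rewrite ℕ.+-identityʳ a = refl
      shanks-step a (suc d) = begin
        term a (suc (suc d)) ⊕ shanks (suc a) (suc d) ⊕ (term a (suc d) ⊕ shanks (suc a) d)
          ≈⟨ interchange (term a (suc (suc d))) _ _ _ ⟩
        term a (suc (suc d)) ⊕ term a (suc d) ⊕ (shanks (suc a) (suc d) ⊕ shanks (suc a) d)
          ≈⟨ R.+-cong (term-step a (suc d)) (shanks-step (suc a) d) ⟩
        t ⊛ factor a ⊕ g ⊕ (term (suc a) d ⊛ factor (suc a) ⊕ pair (suc a + d))
          ≈⟨ R.+-congˡ {t ⊛ factor a ⊕ g} (R.+-cong (term-shift a d)
               (λ n → cong (λ i → pair i n) (sym (ℕ.+-suc a d)))) ⟩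
        t ⊛ factor a ⊕ g ⊕ (g ⊕ pair (a + suc d))
          ≈⟨ solve 3 (λ x g p → x :+ g :+ (g :+ p) := x :+ p) R.refl
               (t ⊛ factor a) g (pair (a + suc d)) ⟩
        t ⊛ factor a ⊕ pair (a + suc d) ∎
        where
        t = term a (suc d)
        g = t ⊛ q (suc (a + suc d) + a)
        interchange : ∀ x y z w → x ⊕ y ⊕ (z ⊕ w) ≈ x ⊕ z ⊕ (y ⊕ w)
        interchange = solve 4 (λ x y z w → x :+ y :+ (z :+ w) := x :+ z :+ (y :+ w)) R.refl

      partial : ℕ → Series
      partial zero    = 1S
      partial (suc n) = partial n ⊕ pair n

      shanks≈partial : ∀ n → shanks 0 n ≈ partial n
      shanks≈partial zero n with ℕ.*-zeroʳ s
      ... | s*0≡0 rewrite s*0≡0 = ⊛-identityˡ 1S n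
      shanks≈partial (suc n) = begin
        shanks 0 (suc n)                              ≈⟨ solve 2 (λ x y → x := y :+ (x :+ y)) R.refl
                                                           (shanks 0 (suc n)) (shanks 0 n) ⟩
        shanks 0 n ⊕ (shanks 0 (suc n) ⊕ shanks 0 n)  ≈⟨ R.+-cong (shanks≈partial n) (shanks-step 0 n) ⟩
        partial n ⊕ (term 0 n ⊛ factor 0 ⊕ pair n)    ≈⟨ R.+-congˡ {partial n} (R.+-congʳ {pair n} vanish) ⟩
        partial n ⊕ pair n                            ∎
        where
        -- The lower end disappears at a = 0, because `factor 0` is 1 + 1.
        vanish : term 0 n ⊛ factor 0 ≈ 0S
        vanish = R.trans (R.*-congˡ {term 0 n} factor-0) (R.zeroʳ (term 0 n))
          where
          factor-0 : factor 0 ≈ 0S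
          factor-0 n rewrite ℕ.*-zeroʳ s = ℙ.p+p≡0ℙ (1S n)

      term-order : ∀ a d {N} → N < s * (suc a + d) → term (suc a) d N ≡ 0ℙ
      term-order a d {N} N< = trans (R.*-comm (ratio (suc a) d) _ N)
        (mono-⊛-< (s * weight (suc a) d) _ N (ℕ.<-≤-trans N< (ℕ.*-monoʳ-≤ s
          (ℕ.≤-trans (ℕ.m≤m+n (suc a + d) (a * (suc a + d))) (ℕ.m≤m+n _ _)))))

      -- Every summand of index at least 1 is divisible by `x^(a + 1 + d)`. In lower degrees the
      -- whole sum from 0 thus reduces to its first summand, which is the product itself.
      shanks-order : ∀ a d {N} → N < s * (suc a + d) → shanks (suc a) d N ≡ 0ℙ
      shanks-order a zero    N< = term-order a 0 N<
      shanks-order a (suc d) {N} N< = cong₂ ℙ._+_ (term-order a (suc d) N<)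
        (shanks-order (suc a) d (subst (λ k → N < s * suc k) (ℕ.+-suc a d) N<))

      ratio≡partial : ∀ n {N} → N < s * n → ratio 0 n N ≡ partial n N
      ratio≡partial zero    {N} N< rewrite ℕ.*-zeroʳ s with () ← N<
      ratio≡partial (suc n) {N} N< = begin′
        where
        ratio≈term : ratio 0 (suc n) ≈ term 0 (suc n)
        ratio≈term rewrite ℕ.*-zeroʳ s = R.sym (R.*-identityʳ (ratio 0 (suc n)))
        begin′ : ratio 0 (suc n) N ≡ partial (suc n) N
        begin′ = trans (ratio≈term N) (trans (sym (ℙ.+-identityʳ _))
          (trans (cong (term 0 (suc n) N ℙ.+_) (sym (shanks-order 0 n N<))) (shanks≈partial (suc n) N)))

      parity-partial : ∀ n N → HasParity (λ i → ∣ i ∣ ≤ n × s * pentagonal i ≡ N) (partial n N)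
      parity-partial zero N = parity-cong
        (λ { (refl , e) → z≤n , e })
        (λ { {+ 0} (z≤n , e) → refl , e })
        (subst (λ k → HasParity (λ i → i ≡ + 0 × s * 0 ≡ N) (mono k N)) (ℕ.*-zeroʳ s)
          (parity-mono (+ 0) (s * 0) N))
      parity-partial (suc n) N = parity-union (parity-partial n N)
        (parity-union {R = λ i → ∣ i ∣ ≡ suc n × s * pentagonal i ≡ N}
          (parity-mono -[1+ n ] (s * pentagonal -[1+ n ]) N)
          (parity-mono (+ suc n) (s * pentagonal (+ suc n)) N)
          (λ { (refl , _) () })
          (λ { {+ _} (refl , e) → inj₂ (refl , e) ; { -[1+ _ ]} (refl , e) → inj₁ (refl , e) })
          (λ { (refl , e) → refl , e })
          (λ { (refl , e) → refl , e }))
        (λ { (∣i∣≤n , _) (∣i∣≡1+n , _) → ℕ.<-irrefl ∣i∣≡1+n (s≤s ∣i∣≤n) })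
        (λ (le , e) → [ (λ lt → inj₁ (ℕ.≤-pred lt , e)) , (λ eq → inj₂ (eq , e)) ]′ (ℕ.m≤n⇒m<n∨m≡n le))
        (λ (le , e) → ℕ.m≤n⇒m≤1+n le , e)
        (λ (eq , e) → ℕ.≤-reflexive eq , e)

    -- Euler's pentagonal number theorem modulo 2.
    parity-pentagonal : ∀ n {N} → N < s * n →
                        HasParity (λ i → s * pentagonal i ≡ N) (ratio 0 n N)
    parity-pentagonal n {N} N< = subst (HasParity _) (sym (ratio≡partial n N<))
      (parity-cong proj₂ (λ {i} e → small i e , e) (parity-partial n N))
      where
      small : ∀ i → s * pentagonal i ≡ N → ∣ i ∣ ≤ n
      small i refl = ℕ.≤-trans (∣i∣≤pentagonal i) (ℕ.<⇒≤ (ℕ.*-cancelˡ-< s _ _ N<))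

-- Series as generating functions of finite fibres modulo 2.

module Theta where

  open Counting
  open import Data.Integer.Base as ℤ using (ℤ; +_; -[1+_]; ∣_∣)
  import Data.Integer.Properties as ℤ
  open import Data.Integer.Tactic.RingSolver using (solve-∀)
  open import Data.List.Base using (List; _++_; length; map; filter; upTo)
  open import Data.List.Membership.Propositional using (_∈_)
  open import Data.List.Membership.Propositional.Properties
    using (∈-filter⁺; ∈-filter⁻; ∈-++⁺ˡ; ∈-++⁺ʳ; ∈-map⁺; ∈-map⁻; ∈-upTo⁺)
  import Data.List.Relation.Unary.Unique.Propositional.Properties as Unique
  open import Data.List.Relation.Unary.Unique.Propositional using (Unique)
  open import Data.Nat.Base using (ℕ; zero; suc; _+_; _*_; _≤_; s≤s; parity; NonZero)
  open import Data.Nat.Divisibility using (_∣_; divides; _∣?_)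
  import Data.Nat.Properties as ℕ
  open import Data.Parity.Base using (0ℙ)
  open import Data.Product.Base using (∃; _×_; _,_; proj₂; swap)
  open import Data.Sum.Base using (inj₁; inj₂)
  open import Function.Base using (_∘_)
  open import Relation.Binary.PropositionalEquality
    using (_≡_; refl; sym; trans; cong; subst)
  open import Relation.Nullary using (¬_; yes; no)
  open Series

  private
    variable
      A B : Set

  Counts : Series → (ℕ → A → Set) → Set
  Counts f P = ∀ n → HasParity (P n) (f n)

  -- The series f is Σ q^(a x) modulo 2, with the finiteness of each fibre as part of the data.
  Graded : Series → (A → ℕ) → Set
  Graded f a = Counts f (λ n x → a x ≡ n)

  -- The recursion follows `_⊛_`: pairs whose first degree is 0, then the others. They are disjoint
  -- because an element has only one degree.
  counts-⊛ : ∀ {f g} {P : ℕ → A → Set} {Q : ℕ → B → Set} →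
             Counts f P → Counts g Q → (∀ {i j x} → P i x → P j x → i ≡ j) →
             Counts (f ⊛ g) (λ n (x , y) → ∃ λ i → ∃ λ j → i + j ≡ n × P i x × Q j y)
  counts-⊛ F G disjoint zero = parity-cong
    (λ (p , q) → 0 , 0 , refl , p , q)
    (λ { (zero , zero , refl , p , q) → p , q })
    (parity-product (F 0) (G 0))
  counts-⊛ F G disjoint (suc n) = parity-union
    (parity-product (F 0) (G (suc n)))
    (counts-⊛ (F ∘ suc) G (λ p p′ → ℕ.suc-injective (disjoint p p′)) n)
    (λ { (p , _) (i , j , _ , p′ , _) → ℕ.0≢1+n (disjoint p p′) })
    (λ { (zero  , _ , refl , p , q) → inj₁ (p , q)
       ; (suc i , j , eq   , p , q) → inj₂ (i , j , ℕ.suc-injective eq , p , q) })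
    (λ (p , q) → 0 , suc n , refl , p , q)
    (λ (i , j , eq , p , q) → suc i , j , cong suc eq , p , q)

  graded-⊛ : ∀ {f g} {a : A → ℕ} {b : B → ℕ} → Graded f a → Graded g b →
             Graded (f ⊛ g) (λ (x , y) → a x + b y)
  graded-⊛ F G n = parity-cong
    (λ { (_ , _ , eq , refl , refl) → eq })
    (λ eq → _ , _ , eq , refl , refl)
    (counts-⊛ F G (λ p p′ → trans (sym p) p′) n)

  graded-cong : ∀ {f} {a b : A → ℕ} → (∀ x → a x ≡ b x) → Graded f a → Graded f b
  graded-cong a≡b F n = parity-cong (trans (sym (a≡b _))) (trans (a≡b _)) (F n)

  graded-unique : ∀ {f g} {a : A → ℕ} → Graded f a → Graded g a → f ≈ g
  graded-unique F G n = parity-unique (F n) (G n)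

  -- The Frobenius identity f(q)² = f(q²): exchanging the entries of a pair changes the sign of x -
  -- y, so only the diagonal survives.
  graded-square : ∀ {f} {a : ℤ → ℕ} → Graded f a → Graded (f ⊛ f) (λ x → 2 * a x)
  graded-square {a = a} F n = transport (record
    { Related    = λ (x , y) z → x ≡ z × y ≡ z
    ; to         = λ { {x , y} (eq , x-y≡0) → let x≡y = ℤ.i-j≡0⇒i≡j x y x-y≡0 in
                       x , trans (double x) (trans (cong (λ z → a x + a z) x≡y) eq) , refl , sym x≡y }
    ; from       = λ {z} eq → (z , z) , (trans (sym (double z)) eq , ℤ.i≡j⇒i-j≡0 {z} refl) , refl , refl
    ; injective  = λ { _ _ (refl , refl) (refl , refl) → refl }
    ; functional = λ { _ _ (refl , refl) (refl , refl) → refl }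
    }) (parity-fold swap (λ (x , y) → x ℤ.- y) (λ _ → refl) (λ (x , y) → negate x y)
         (λ { {x , y} eq → trans (ℕ.+-comm (a y) (a x)) eq }) (graded-⊛ F F n))
    where
    double : ∀ x → 2 * a x ≡ a x + a x
    double x = cong (λ m → a x + m) (ℕ.+-identityʳ (a x))
    negate : ∀ x y → y ℤ.- x ≡ ℤ.- (x ℤ.- y)
    negate = solve-∀

  graded-multiple : ∀ {f g} {a : A → ℕ} k .{{_ : NonZero k}} →
                    Graded f a → Graded g (λ x → k * a x) → ∀ n → g (k * n) ≡ f n
  graded-multiple k F G n = parity-unique (G (k * n)) (parity-cong (cong (k *_)) (ℕ.*-cancelˡ-≡ _ _ k) (F n))

  graded-nonmultiple : ∀ {g} {a : A → ℕ} k → Graded g (λ x → k * a x) → ∀ {n} → ¬ k ∣ n → g n ≡ 0ℙ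
  graded-nonmultiple {a = a} k G {n} k∤n = parity-unique (G n)
    (parity-empty (λ {x} eq → k∤n (divides (a x) (trans (sym eq) (ℕ.*-comm k (a x))))))

  -- Two weights with the same series still share one after q ↦ q^k. This carries the formula for
  -- f₁³ over to f₃³.
  graded-scale : ∀ {f g} {a : A → ℕ} {b : B → ℕ} k .{{_ : NonZero k}} → Graded f a → Graded f b →
                 Graded g (λ x → k * a x) → Graded g (λ x → k * b x)
  graded-scale {f = f} {g} {b = b} k F F′ G n with k ∣? n
  ... | yes (divides m refl) = subst (HasParity _)
          (trans (sym (graded-multiple k F G m)) (cong g (ℕ.*-comm k m)))
          (parity-cong (λ { refl → ℕ.*-comm k m }) (λ eq → ℕ.*-cancelˡ-≡ _ _ k (trans eq (ℕ.*-comm m k))) (F′ m))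
  ... | no k∤n = subst (HasParity _) (sym (graded-nonmultiple k G k∤n))
          (parity-empty (λ {x} eq → k∤n (divides (b x) (trans (sym eq) (ℕ.*-comm k (b x))))))

  interval : ℕ → List ℤ
  interval n = map +_ (upTo (suc n)) ++ map -[1+_] (upTo n)

  ∈-interval : ∀ {n i} → ∣ i ∣ ≤ n → i ∈ interval n
  ∈-interval {i = + _}      i≤n = ∈-++⁺ˡ (∈-map⁺ +_ (∈-upTo⁺ (s≤s i≤n)))
  ∈-interval {n} { -[1+ _ ]} i<n = ∈-++⁺ʳ (map +_ (upTo (suc n))) (∈-map⁺ -[1+_] (∈-upTo⁺ i<n))

  interval-unique : ∀ n → Unique (interval n)
  interval-unique n = Unique.++⁺
    (Unique.map⁺ ℤ.+-injective (Unique.upTo⁺ (suc n)))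
    (Unique.map⁺ ℤ.-[1+-injective (Unique.upTo⁺ n))
    (λ (x∈ , x∈′) → opposite (∈-map⁻ +_ x∈) (∈-map⁻ -[1+_] x∈′))
    where
    opposite : ∀ {x xs ys} → (∃ λ j → j ∈ xs × x ≡ + j) → ¬ ∃ λ j → j ∈ ys × x ≡ -[1+ j ]
    opposite (_ , _ , refl) (_ , _ , ())

  -- The search covers |i| ≤ n only; it is exhaustive for weights that satisfy |i| ≤ a i.
  theta : (ℤ → ℕ) → Series
  theta a n = parity (length (filter (λ i → a i ℕ.≟ n) (interval n)))

  theta-graded : ∀ {a} → (∀ i → ∣ i ∣ ≤ a i) → Graded (theta a) a
  theta-graded {a} ∣i∣≤a n = enumerated
    (Unique.filter⁺ (λ i → a i ℕ.≟ n) (interval-unique n))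
    (λ x∈ → proj₂ (∈-filter⁻ (λ i → a i ℕ.≟ n) {xs = interval n} x∈))
    (λ { {i} refl → ∈-filter⁺ (λ j → a j ℕ.≟ n) (∈-interval (∣i∣≤a i)) refl })
    refl

-- The product formula for regular partitions modulo 2, through finite products.

module Partitions where

  open import Algebra.Bundles using (CommutativeRing)
  open Counting
  open import Data.List.Base using (List; []; _∷_; filter; length)
  open import Data.List.Membership.Propositional.Properties using (∈-filter⁺; ∈-filter⁻)
  open import Data.List.Relation.Unary.All as All using (All; []; _∷_; all?)
  open import Data.List.Relation.Unary.Linked as Linked using (Linked; []; [-]; _∷_)
  open import Data.List.Relation.Unary.Linked.Properties using (Linked⇒All)
  import Data.List.Relation.Unary.Unique.Propositional.Properties as Unique
  open import Data.Nat.Base using (ℕ; zero; suc; _+_; _*_; _≤_; _<_; _≥_; z≤n; s≤s; parity; NonZero)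
  open import Data.Nat.Divisibility using (_∣_; _∣?_; m∣m*n; ∣m+n∣m⇒∣n; >⇒∤)
  import Data.Nat.Properties as ℕ
  open import Data.Parity.Base as ℙ using (1ℙ)
  import Data.Parity.Properties as ℙ
  open import Data.Product.Base using (∃; _×_; _,_; proj₁)
  open import Data.Sum.Base using (_⊎_; inj₁; inj₂)
  open import Function.Bundles using (Equivalence)
  open import Defs
  open Pentagonal
  open import Relation.Binary.PropositionalEquality
    using (_≡_; refl; sym; trans; cong; subst)
  open import Relation.Nullary using (¬_; Dec; yes; no; contradiction)
  open Series
  open Theta
  open Solver using (solve; _:+_; _:*_; _:=_; con)

  module _ (ℓ : ℕ) where

    Bounded : ℕ → ℕ → List ℕ → Set
    Bounded k n parts = IsRegularPartition ℓ n parts × All (_≤ k) parts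

    regularSeries : Series
    regularSeries n = parity (b ℓ n)

    -- The bound k on the parts replaces the infinite product by a finite one; coefficient n is
    -- already exact for k ≥ n.
    boundedSeries : ℕ → Series
    boundedSeries k n = parity (length (filter (all? (ℕ._≤? k)) (regularPartitions ℓ n)))

    regularSeries-counts : Counts regularSeries (IsRegularPartition ℓ)
    regularSeries-counts n = enumerated (regularPartitions-unique ℓ n)
      (Equivalence.to (∈-regularPartitions ℓ n)) (Equivalence.from (∈-regularPartitions ℓ n)) refl

    boundedSeries-counts : ∀ k → Counts (boundedSeries k) (Bounded k)
    boundedSeries-counts k n = enumerated
      (Unique.filter⁺ (all? (ℕ._≤? k)) (regularPartitions-unique ℓ n))
      (λ p∈ → let p∈′ , ≤k = ∈-filter⁻ (all? (ℕ._≤? k)) {xs = regularPartitions ℓ n} p∈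
              in Equivalence.to (∈-regularPartitions ℓ n) p∈′ , ≤k)
      (λ (reg , ≤k) → ∈-filter⁺ (all? (ℕ._≤? k)) (Equivalence.from (∈-regularPartitions ℓ n) reg) ≤k)
      refl

    parts≤n : ∀ {n parts} → IsRegularPartition ℓ n parts → All (_≤ n) parts
    parts≤n {parts = parts} (isRegularPartition (isPartition _ _ refl) _) = parts≤sum parts

    bounded-large : ∀ {k n} → n ≤ k → boundedSeries k n ≡ regularSeries n
    bounded-large {k} {n} n≤k = parity-unique (boundedSeries-counts k n)
      (parity-cong (λ reg → reg , All.map (λ p≤n → ℕ.≤-trans p≤n n≤k) (parts≤n reg)) proj₁
        (regularSeries-counts n))

    bounded-0 : boundedSeries 0 ≈ 1S
    bounded-0 zero    = parity-unique (boundedSeries-counts 0 0)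
      (parity-singleton [] (isRegularPartition (isPartition [] [] refl) [] , [])
        λ { {[]} _ → refl
          ; {_ ∷ _} (isRegularPartition (isPartition (() ∷ _) _ _) _ , z≤n ∷ _) })
    bounded-0 (suc n) = parity-unique (boundedSeries-counts 0 (suc n))
      (parity-empty
        λ { {[]} (isRegularPartition (isPartition _ _ ()) _ , _)
          ; {_ ∷ _} (isRegularPartition (isPartition (() ∷ _) _ _) _ , z≤n ∷ _) })

    bounded-suc-∣ : ∀ {k} → ℓ ∣ suc k → boundedSeries (suc k) ≈ boundedSeries k
    bounded-suc-∣ {k} ℓ∣ n = parity-unique (boundedSeries-counts (suc k) n)
      (parity-cong (λ (reg , ≤k) → reg , All.map ℕ.m≤n⇒m≤1+n ≤k)
                   (λ (reg , ≤1+k) → reg , All.zipWith lower (IsRegularPartition.regular reg , ≤1+k))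
                   (boundedSeries-counts k n))
      where
      lower : ∀ {p} → (¬ ℓ ∣ p) × p ≤ suc k → p ≤ k
      lower (ℓ∤p , p≤) = ℕ.≤-pred (ℕ.≤∧≢⇒< p≤ (λ { refl → ℓ∤p ℓ∣ }))

    -- A partition either has all its parts at most k or begins with k + 1; deletion of that first
    -- part leaves an arbitrary partition of n - (k + 1) with the same bound.
    bounded-suc-∤ : ∀ {k} → ¬ ℓ ∣ suc k →
                    boundedSeries (suc k) ≈ boundedSeries k ⊕ mono (suc k) ⊛ boundedSeries (suc k)
    bounded-suc-∤ {k} ℓ∤ n with n ℕ.≤? k
    ... | yes n≤k = trans (bounded-large (ℕ.m≤n⇒m≤1+n n≤k)) (trans (sym (bounded-large n≤k))
            (trans (sym (ℙ.+-identityʳ _)) (cong (boundedSeries k n ℙ.+_)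
              (sym (mono-⊛-< (suc k) (boundedSeries (suc k)) n (s≤s n≤k))))))
    ... | no n≰k with m , refl ← ℕ.m≤n⇒∃[o]m+o≡n (ℕ.≰⇒> n≰k) =
      trans
        (parity-unique (boundedSeries-counts (suc k) (suc k + m))
          (parity-union (boundedSeries-counts k (suc k + m)) (transport prepend (boundedSeries-counts (suc k) m))
            (λ { (_ , ≤k) (_ , ≰k) → ≰k ≤k })
            split
            (λ (reg , ≤k) → reg , All.map ℕ.m≤n⇒m≤1+n ≤k)
            proj₁))
        (cong (boundedSeries k (suc k + m) ℙ.+_) (sym (mono-⊛-+ (suc k) (boundedSeries (suc k)) m)))
      where
      split : ∀ {parts} → Bounded (suc k) (suc k + m) parts →
              Bounded k (suc k + m) parts ⊎ (Bounded (suc k) (suc k + m) parts × ¬ All (_≤ k) parts)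
      split {parts} (reg , ≤1+k) with all? (ℕ._≤? k) parts
      ... | yes ≤k = inj₁ (reg , ≤k)
      ... | no  ≰k = inj₂ ((reg , ≤1+k) , ≰k)

      cons-decreasing : ∀ {parts} → All (_≤ suc k) parts → Linked _≥_ parts → Linked _≥_ (suc k ∷ parts)
      cons-decreasing []       []  = [-]
      cons-decreasing (p ∷ ps) dec = p ∷ dec

      behead : ∀ {parts} → Bounded (suc k) (suc k + m) parts × ¬ All (_≤ k) parts →
               ∃ λ rest → Bounded (suc k) m rest × parts ≡ suc k ∷ rest
      behead {[]}    (_ , ≰k) = contradiction [] ≰k
      behead {p ∷ _} ((isRegularPartition (isPartition (_ ∷ pos) dec total) (_ ∷ reg) , p≤ ∷ ≤1+k) , ≰k)
        with ℕ.m≤n⇒m<n∨m≡n p≤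
      -- The parts decrease, so a head of at most k would bound all of them by k.
      ... | inj₁ (s≤s p≤k) = contradiction (Linked⇒All (λ i≥j j≥k → ℕ.≤-trans j≥k i≥j) p≤k dec) ≰k
      ... | inj₂ refl = _ , (isRegularPartition (isPartition pos (Linked.tail dec)
                          (ℕ.+-cancelˡ-≡ (suc k) _ _ total)) reg , ≤1+k) , refl

      prepend : Correspondence (Bounded (suc k) m)
                  (λ parts → Bounded (suc k) (suc k + m) parts × ¬ All (_≤ k) parts)
      prepend = record
        { Related    = λ rest parts → parts ≡ suc k ∷ rest
        ; to         = λ { (isRegularPartition (isPartition pos dec total) reg , ≤1+k) →
                         _ , ((isRegularPartition (isPartition (s≤s z≤n ∷ pos) (cons-decreasing ≤1+k dec)
                                (cong (suc k +_) total)) (ℓ∤ ∷ reg) , ℕ.≤-refl ∷ ≤1+k)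
                             , λ { (1+k≤k ∷ _) → ℕ.<-irrefl refl 1+k≤k }) , refl }
        ; from       = behead
        ; injective  = λ { _ _ refl refl → refl }
        ; functional = λ { _ _ refl refl → refl }
        }

    multiplesStep : ∀ k → Dec (ℓ ∣ suc k) → Series → Series
    multiplesStep k (yes _) f = factor 1 (suc k) ⊛ f
    multiplesStep k (no _)  f = f

    -- The numerator of the product formula, truncated at degree k: the product of 1 + q^j over the
    -- multiples j of ℓ with 0 < j ≤ k.
    multiples : ℕ → Series
    multiples zero    = 1S
    multiples (suc k) = multiplesStep k (ℓ ∣? suc k) (multiples k)

    private
      module R = CommutativeRing seriesRing
      open import Relation.Binary.Reasoning.Setoid R.setoid

    -- If ℓ divides k + 1, the new factor passes to the numerator. Otherwise the recursion B = B′ +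
    -- q^(k+1) B absorbs it, as (1 + q^(k+1)) B = B′ modulo 2.
    bounded-⊛-ratio : ∀ k → boundedSeries k ⊛ ratio 1 0 k ≈ multiples k
    bounded-⊛-ratio zero    = R.trans (R.*-identityʳ (boundedSeries 0)) bounded-0
    bounded-⊛-ratio (suc k) with ℓ ∣? suc k
    ... | yes ℓ∣ = begin
      boundedSeries (suc k) ⊛ (factor 1 (suc k) ⊛ ratio 1 0 k)
        ≈⟨ R.*-congʳ (bounded-suc-∣ ℓ∣) ⟩
      boundedSeries k ⊛ (factor 1 (suc k) ⊛ ratio 1 0 k)
        ≈⟨ solve 3 (λ x y z → x :* (y :* z) := y :* (x :* z)) R.refl (boundedSeries k) _ _ ⟩
      factor 1 (suc k) ⊛ (boundedSeries k ⊛ ratio 1 0 k)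
        ≈⟨ R.*-congˡ (bounded-⊛-ratio k) ⟩
      factor 1 (suc k) ⊛ multiples k ∎
    ... | no ℓ∤ = begin
      B ⊛ ((1S ⊕ q 1 (suc k)) ⊛ ratio 1 0 k)
        ≈⟨ R.*-congˡ {B} (R.*-congʳ {ratio 1 0 k} (R.+-congˡ {1S}
             (λ n → cong (λ j → mono j n) (ℕ.*-identityˡ (suc k))))) ⟩
      B ⊛ ((1S ⊕ mono (suc k)) ⊛ ratio 1 0 k)
        ≈⟨ solve 3 (λ x y z → x :* ((con 1ℙ :+ y) :* z) := (x :+ y :* x) :* z) R.refl B (mono (suc k)) _ ⟩
      (B ⊕ mono (suc k) ⊛ B) ⊛ ratio 1 0 k
        ≈⟨ R.*-congʳ (R.+-congʳ {mono (suc k) ⊛ B} (bounded-suc-∤ ℓ∤)) ⟩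
      (boundedSeries k ⊕ mono (suc k) ⊛ B ⊕ mono (suc k) ⊛ B) ⊛ ratio 1 0 k
        ≈⟨ R.*-congʳ (solve 2 (λ x y → x :+ y :+ y := x) R.refl (boundedSeries k) (mono (suc k) ⊛ B)) ⟩
      boundedSeries k ⊛ ratio 1 0 k
        ≈⟨ bounded-⊛-ratio k ⟩
      multiples k ∎
      where B = boundedSeries (suc k)

  -- No multiple of ℓ lies strictly between ℓL and ℓ(L + 1).
  multiples-between : ∀ ℓ j L → j < ℓ → multiples ℓ (j + ℓ * L) ≈ multiples ℓ (ℓ * L)
  multiples-between ℓ zero    L _   n = refl
  multiples-between ℓ (suc j) L j<ℓ n with ℓ ∣? suc (j + ℓ * L)
  ... | yes ℓ∣ = contradiction (∣m+n∣m⇒∣n (subst (ℓ ∣_) (ℕ.+-comm (suc j) (ℓ * L)) ℓ∣) (m∣m*n L)) (>⇒∤ j<ℓ)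
  ... | no  _  = multiples-between ℓ j L (ℕ.<-trans (ℕ.n<1+n j) j<ℓ) n

  multiples-suc : ∀ ℓ k → ℓ ∣ suc k → multiples ℓ (suc k) ≈ factor 1 (suc k) ⊛ multiples ℓ k
  multiples-suc ℓ k ℓ∣ n with ℓ ∣? suc k
  ... | yes _  = refl
  ... | no  ℓ∤ = contradiction ℓ∣ ℓ∤

  multiples-ratio : ∀ ℓ .{{_ : NonZero ℓ}} L → multiples ℓ (ℓ * L) ≈ ratio ℓ 0 L
  multiples-ratio (suc j) zero    n = cong (λ k → multiples (suc j) k n) (ℕ.*-zeroʳ j)
  multiples-ratio ℓ@(suc j) (suc L) n =
    trans (cong (λ k → multiples ℓ k n) (ℕ.*-suc ℓ L))
    (trans (multiples-suc ℓ (j + ℓ * L) (subst (ℓ ∣_) (ℕ.*-suc ℓ L) (m∣m*n (suc L))) n)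
    (⊛-cong
      (λ m → cong (λ i → (1S ⊕ mono i) m) (trans (ℕ.*-identityˡ _) (sym (ℕ.*-suc ℓ L))))
      (λ m → trans (multiples-between ℓ j L (ℕ.n<1+n j) m) (multiples-ratio ℓ L m)) n))

  regular-⊛-pentagonal : ∀ ℓ .{{_ : NonZero ℓ}} {f g} → Graded f pentagonal →
                         Graded g (λ i → ℓ * pentagonal i) → regularSeries ℓ ⊛ f ≈ g
  regular-⊛-pentagonal ℓ {f} {g} F G N =
    trans (⊛-cong-≤ N
            (λ m≤N → sym (bounded-large ℓ (ℕ.≤-trans m≤N (ℕ.<⇒≤ N<K))))
            (λ {m} m≤N → parity-unique
              (parity-cong (trans (ℕ.*-identityˡ _)) (trans (sym (ℕ.*-identityˡ _))) (F m))
              (parity-pentagonal 1 K (subst (m <_) (sym (ℕ.*-identityˡ K)) (ℕ.≤-<-trans m≤N N<K)))))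
    (trans (bounded-⊛-ratio ℓ K N)
    (trans (multiples-ratio ℓ (suc N) N)
           (parity-unique (parity-pentagonal ℓ (suc N) N<K) (G N))))
    where
    -- A bound above N, so that no relevant part or factor is lost, and a multiple of ℓ, so that the
    -- numerator is exactly the product of N + 1 factors in q^ℓ.
    K = ℓ * suc N
    N<K : N < K
    N<K = ℕ.m≤n*m (suc N) ℓ

-- Congruences, and the exponents as integer polynomials.

module Integers where

  open import Data.Empty using (⊥; ⊥-elim)
  open import Data.Integer.Base using (ℤ; +_; -[1+_]; _+_; _-_; _*_; -_)
  import Data.Integer.Divisibility.Signed as Signed
  open import Data.Integer.DivMod using (_%ℕ_; _/ℕ_; n%ℕd<d; a≡a%ℕn+[a/ℕn]*n)
  import Data.Integer.Properties as ℤ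
  open import Data.Integer.Tactic.RingSolver using (solve-∀)
  open import Data.Nat.Base as ℕ using (ℕ; zero; suc; NonZero; s≤s)
  open import Data.Nat.Divisibility using (>⇒∤)
  import Data.Nat.Properties as ℕ
  open import Data.Product.Base using (∃; _×_; _,_)
  open import Relation.Binary.PropositionalEquality
    using (_≡_; refl; sym; trans; cong)
  open import Relation.Nullary.Decidable using (True; toWitness)
  open Pentagonal using (triangular; pentagonal)

  -- Polynomial certificates: once c is known, the last premise is left to the ring solver.
  combine : ∀ {L R A B} c → L ≡ R → A ≡ B + c * (L - R) → A ≡ B
  combine {L} {B = B} c refl A≡ = trans A≡ (vanish L B c)
    where
    vanish : ∀ L B c → B + c * (L - L) ≡ B
    vanish = solve-∀

  residue : ∀ k .{{_ : NonZero k}} x → ∃ λ r → r ℕ.< k × ∃ λ t → x ≡ + k * t + + r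
  residue k x = x %ℕ k , n%ℕd<d x k , x /ℕ k ,
    trans (a≡a%ℕn+[a/ℕn]*n x k) (swap (+ (x %ℕ k)) (x /ℕ k) (+ k))
    where
    swap : ∀ r t k → r + t * k ≡ k * t + r
    swap = solve-∀

  -- The bound r < k is decided by evaluation, so that excluding a residue class costs one
  -- polynomial identity.
  incongruent : ∀ k r .{{_ : NonZero r}} {r<k : True (r ℕ.<? k)} x y → + k * x ≡ + k * y + + r → ⊥
  incongruent k r {r<k} x y eq = >⇒∤ (toWitness r<k)
    (Signed.∣⇒∣ᵤ {i = + r} (Signed.divides (x - y)
      (combine (- (+ 1)) eq (difference (+ k) x y (+ r)))))
    where
    difference : ∀ k x y r → r ≡ (x - y) * k + - (+ 1) * (k * x - (k * y + r))
    difference = solve-∀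

  even-square : ∀ x w → x * x ≡ + 2 * w → ∃ λ t → x ≡ + 2 * t
  even-square x w eq with residue 2 x
  ... | 0 , _ , t , refl = t , ℤ.+-identityʳ (+ 2 * t)
  ... | suc (suc _) , s≤s (s≤s ()) , _
  ... | 1 , _ , t , refl = ⊥-elim (incongruent 2 1 w (+ 2 * t * t + + 2 * t)
          (combine (+ 1) (sym eq) (step t w)))
    where
    step : ∀ t w → + 2 * w ≡ + 2 * (+ 2 * t * t + + 2 * t) + + 1 +
                   + 1 * (+ 2 * w - (+ 2 * t + + 1) * (+ 2 * t + + 1))
    step = solve-∀

  cancel : ∀ k .{{_ : NonZero k}} c {m n} → + k * + m + c ≡ + k * + n + c → m ≡ n
  cancel (suc k) c {m} {n} eq = ℤ.+-injective
    (ℤ.*-cancelˡ-≡ (+ suc k) (+ m) (+ n) (combine (+ 1) eq (difference (+ suc k) (+ m) (+ n) c)))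
    where
    difference : ∀ k m n c → k * m ≡ k * n + + 1 * (k * m + c - (k * n + c))
    difference = solve-∀

  -- i(2i+1)
  triangularℤ : ℤ → ℕ
  triangularℤ (+ n)    = n ℕ.* (2 ℕ.* n ℕ.+ 1)
  triangularℤ -[1+ n ] = suc n ℕ.* (2 ℕ.* n ℕ.+ 1)

  -- l(3l+2)
  octagonal : ℤ → ℕ
  octagonal (+ n)    = n ℕ.* (3 ℕ.* n ℕ.+ 2)
  octagonal -[1+ n ] = suc n ℕ.* (3 ℕ.* n ℕ.+ 1)

  2*triangular : ∀ n → + 2 * + triangular n ≡ + n * + n + + n
  2*triangular zero    = refl
  2*triangular (suc n) = combine (+ 1) (2*triangular n) (step (+ n) (+ triangular n))
    where
    step : ∀ n t → + 2 * (+ 1 + n + t) ≡ (+ 1 + n) * (+ 1 + n) + (+ 1 + n) + + 1 * (+ 2 * t - (n * n + n))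
    step = solve-∀

  2*pentagonal : ∀ i → + 2 * + pentagonal i ≡ i * (+ 3 * i + + 1)
  2*pentagonal (+ n) = trans
    (cong (λ s → + 2 * (s + + triangular n)) (ℤ.pos-* n n))
    (combine (+ 1) (2*triangular n) (step (+ n) (+ triangular n)))
    where
    step : ∀ n t → + 2 * (n * n + t) ≡ n * (+ 3 * n + + 1) + + 1 * (+ 2 * t - (n * n + n))
    step = solve-∀
  2*pentagonal -[1+ n ] = trans
    (cong (λ s → + 2 * (s + + triangular n)) (ℤ.pos-* (suc n) (suc n)))
    (combine (+ 1) (2*triangular n) (step (+ n) (+ triangular n)))
    where
    step : ∀ n t → + 2 * ((+ 1 + n) * (+ 1 + n) + t) ≡
                   - (+ 1 + n) * (+ 3 * - (+ 1 + n) + + 1) + + 1 * (+ 2 * t - (n * n + n))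
    step = solve-∀

  pos-*-linear : ∀ m k n c → + (m ℕ.* (k ℕ.* n ℕ.+ c)) ≡ + m * (+ k * + n + + c)
  pos-*-linear m k n c = trans (ℤ.pos-* m _) (cong (λ z → + m * (z + + c)) (ℤ.pos-* k n))

  pos-triangularℤ : ∀ i → + triangularℤ i ≡ i * (+ 2 * i + + 1)
  pos-triangularℤ (+ n)    = pos-*-linear n 2 n 1
  pos-triangularℤ -[1+ n ] = trans (pos-*-linear (suc n) 2 n 1) (step (+ n))
    where
    step : ∀ n → (+ 1 + n) * (+ 2 * n + + 1) ≡ - (+ 1 + n) * (+ 2 * - (+ 1 + n) + + 1)
    step = solve-∀

  pos-octagonal : ∀ i → + octagonal i ≡ i * (+ 3 * i + + 2)
  pos-octagonal (+ n)    = pos-*-linear n 3 n 2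
  pos-octagonal -[1+ n ] = trans (pos-*-linear (suc n) 3 n 1) (step (+ n))
    where
    step : ∀ n → (+ 1 + n) * (+ 3 * n + + 1) ≡ - (+ 1 + n) * (+ 3 * - (+ 1 + n) + + 2)
    step = solve-∀

  square-≢2mod3 : ∀ x k → x * x ≡ + 3 * k + + 2 → ⊥
  square-≢2mod3 x k eq with residue 3 x
  ... | 0 , _ , t , refl = incongruent 3 2 (+ 3 * (t * t)) k (combine (+ 1) eq (step t k))
    where
    step : ∀ t k → + 3 * (+ 3 * (t * t)) ≡
           + 3 * k + + 2 + + 1 * ((+ 3 * t + + 0) * (+ 3 * t + + 0) - (+ 3 * k + + 2))
    step = solve-∀
  ... | 1 , _ , t , refl = incongruent 3 1 (+ 3 * (t * t) + + 2 * t) k (combine (+ 1) eq (step t k))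
    where
    step : ∀ t k → + 3 * (+ 3 * (t * t) + + 2 * t) ≡
           + 3 * k + + 1 + + 1 * ((+ 3 * t + + 1) * (+ 3 * t + + 1) - (+ 3 * k + + 2))
    step = solve-∀
  ... | 2 , _ , t , refl = incongruent 3 1 (+ 3 * (t * t) + + 4 * t + + 1) k (combine (+ 1) eq (step t k))
    where
    step : ∀ t k → + 3 * (+ 3 * (t * t) + + 4 * t + + 1) ≡
           + 3 * k + + 1 + + 1 * ((+ 3 * t + + 2) * (+ 3 * t + + 2) - (+ 3 * k + + 2))
    step = solve-∀
  ... | suc (suc (suc _)) , s≤s (s≤s (s≤s ())) , _

  square-≢3mod4 : ∀ x k → x * x ≡ + 4 * k + + 3 → ⊥
  square-≢3mod4 x k eq with residue 2 x
  ... | 0 , _ , t , refl = incongruent 4 3 (t * t) k (combine (+ 1) eq (step t k))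
    where
    step : ∀ t k → + 4 * (t * t) ≡
           + 4 * k + + 3 + + 1 * ((+ 2 * t + + 0) * (+ 2 * t + + 0) - (+ 4 * k + + 3))
    step = solve-∀
  ... | 1 , _ , t , refl = incongruent 4 2 (t * t + t) k (combine (+ 1) eq (step t k))
    where
    step : ∀ t k → + 4 * (t * t + t) ≡
           + 4 * k + + 2 + + 1 * ((+ 2 * t + + 1) * (+ 2 * t + + 1) - (+ 4 * k + + 3))
    step = solve-∀
  ... | suc (suc _) , s≤s (s≤s ()) , _

-- Folding representations by x² + 2y².

module SqrtMinusTwo where

  open Counting
  open import Data.Empty using (⊥-elim)
  open import Data.Integer.Base using (ℤ; +_; _+_; _-_; _*_; -_; 0ℤ)
  import Data.Integer.Properties as ℤ
  open import Data.Integer.Tactic.RingSolver using (solve-∀)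
  open import Data.Nat.Base using (suc; s≤s)
  open import Data.Parity.Base using (Parity)
  open import Data.Product.Base using (∃; _×_; _,_; proj₁; proj₂)
  open import Data.Sum.Base using (_⊎_; inj₁; inj₂)
  open Integers
  open import Relation.Binary.PropositionalEquality
    using (_≡_; refl; sym; trans; cong; cong₂)
  open import Relation.Nullary using (¬_)
  open Series
  open Theta

  private
    variable
      p : Parity

  -- ((3i+1)² + 2(3j+1)²) / 3
  core : ℤ → ℤ → ℤ
  core i j = + 3 * (i * i) + + 2 * i + + 6 * (j * j) + + 4 * j + + 1

  CoreSet : ℤ → ℤ × ℤ → Set
  CoreSet m (i , j) = core i j ≡ m

  -- φ multiplies (3i+1) + (3j+1)√-2 by -(1 + √-2).
  core-descent : ∀ m → HasParity (CoreSet (+ 3 * m)) p → HasParity (CoreSet m) p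
  core-descent m = parity-substitute φ ρ
    (λ { {i , j} H → cong₂ _,_ (combine (- (+ 2)) H (φρ₁ i j m)) (φρ₂ i j m) })
    (λ { {i , j} H → cong₂ _,_ (combine (+ 2) H (ρφ₁ i j m)) (combine (- (+ 2)) H (ρφ₂ i j m)) })
    (λ { {i , j} H → trans (norm i j) (cong (+ 3 *_) H) })
    (λ { {i , j} H → ℤ.*-cancelˡ-≡ (+ 3) (core i j) m (trans (sym (norm i j)) H) })
    where
    φ ρ : ℤ × ℤ → ℤ × ℤ
    φ (i , j) = + 2 * j - i , - i - j - + 1
    ρ (i , j) = i + + 2 * j - + 2 * (m - i * i - + 2 * (j * j))
              , - (i + + 2 * j - + 2 * (m - i * i - + 2 * (j * j))) - j - + 1
    norm : ∀ i j → + 3 * ((+ 2 * j - i) * (+ 2 * j - i)) + + 2 * (+ 2 * j - i)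
             + + 6 * ((- i - j - + 1) * (- i - j - + 1)) + + 4 * (- i - j - + 1) + + 1
           ≡ + 3 * (+ 3 * (i * i) + + 2 * i + + 6 * (j * j) + + 4 * j + + 1)
    norm = solve-∀
    φρ₁ : ∀ i j m → + 2 * (- (i + + 2 * j - + 2 * (m - i * i - + 2 * (j * j))) - j - + 1)
             - (i + + 2 * j - + 2 * (m - i * i - + 2 * (j * j)))
           ≡ i + - (+ 2) * (+ 3 * (i * i) + + 2 * i + + 6 * (j * j) + + 4 * j + + 1 - + 3 * m)
    φρ₁ = solve-∀
    φρ₂ : ∀ i j m → - (i + + 2 * j - + 2 * (m - i * i - + 2 * (j * j)))
             - (- (i + + 2 * j - + 2 * (m - i * i - + 2 * (j * j))) - j - + 1) - + 1 ≡ j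
    φρ₂ = solve-∀
    ρφ₁ : ∀ i j m → + 2 * j - i + + 2 * (- i - j - + 1)
             - + 2 * (m - (+ 2 * j - i) * (+ 2 * j - i) - + 2 * ((- i - j - + 1) * (- i - j - + 1)))
           ≡ i + + 2 * (+ 3 * (i * i) + + 2 * i + + 6 * (j * j) + + 4 * j + + 1 - m)
    ρφ₁ = solve-∀
    ρφ₂ : ∀ i j m → - (+ 2 * j - i + + 2 * (- i - j - + 1)
             - + 2 * (m - (+ 2 * j - i) * (+ 2 * j - i) - + 2 * ((- i - j - + 1) * (- i - j - + 1))))
             - (- i - j - + 1) - + 1
           ≡ j + - (+ 2) * (+ 3 * (i * i) + + 2 * i + + 6 * (j * j) + + 4 * j + + 1 - m)
    ρφ₂ = solve-∀

  fold-second : ∀ {P : ℤ × ℤ → Set} → (∀ {x y} → P (x , y) → P (x , - y)) →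
                HasParity P p → HasParity (λ x → P (x , 0ℤ)) p
  fold-second P-even E = pullback (λ x → x , 0ℤ) (λ _ _ → cong proj₁) (λ Px → Px , refl)
    (λ { {x , _} (Px , refl) → x , Px , refl })
    (parity-fold (λ (x , y) → x , - y) proj₂ (λ (x , y) → cong (x ,_) (ℤ.neg-involutive y))
      (λ _ → refl) P-even E)

  fold-first : ∀ {P : ℤ × ℤ → Set} → (∀ {x y} → P (x , y) → P (- x , y)) →
               HasParity P p → HasParity (λ y → P (0ℤ , y)) p
  fold-first P-even E = pullback (λ y → 0ℤ , y) (λ _ _ → cong proj₂) (λ Py → Py , refl)
    (λ { {_ , y} (Py , refl) → y , Py , refl })
    (parity-fold (λ (x , y) → - x , y) proj₁ (λ (x , y) → cong (_, y) (ℤ.neg-involutive x))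
      (λ _ → refl) P-even E)

  -- The quotient of (3i+1) + (3j+1)√-2 by 1 + √-2 is (i+2j+1) + (j-i)√-2, of norm `core i j`. If
  -- this norm is 1 modulo 3, the quotient has the form (3s+1) + 3t√-2; here t can change sign, and
  -- only t = 0 survives.
  core-1mod3 : ∀ k → HasParity (CoreSet (+ 3 * k + + 1)) p →
               HasParity (λ s → (+ 3 * s + + 1) * (+ 3 * s + + 1) ≡ + 3 * k + + 1) p
  core-1mod3 k E = parity-cong (λ {s} H → trans (sym (drop s)) H) (λ {s} H → trans (drop s) H)
    (fold-second {P = λ (s , t) → (+ 3 * s + + 1) * (+ 3 * s + + 1) + + 18 * (t * t) ≡ + 3 * k + + 1}
      (λ {s} {t} H → trans (flip s t) H)
    (parity-substitute φ ρ
      (λ { {i , j} H → cong₂ _,_ (φρ₁ i j k) (combine (- (+ 1)) H (φρ₂ i j k)) })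
      (λ { {s , t} H → cong₂ _,_
        (ℤ.*-cancelˡ-≡ (+ 3) _ s (combine (- (+ 2)) H (ρφ₁ s t k)))
        (ℤ.*-cancelˡ-≡ (+ 3) _ t (combine (- (+ 1)) H (ρφ₂ s t k))) })
      (λ { {s , t} H → trans (norm s t) H })
      (λ { {s , t} H → trans (sym (norm s t)) H }) E))
    where
    φ ρ : ℤ × ℤ → ℤ × ℤ
    φ (s , t) = s - + 2 * t , s + t
    -- On solutions the second entry is t = (j - i)/3; the equation `core i j = 3k + 1` supplies the
    -- division.
    ρ (i , j) = i + + 2 * (k - i * i - + 2 * (j * j) - i - j) , k - i * i - + 2 * (j * j) - i - j
    drop : ∀ s → (+ 3 * s + + 1) * (+ 3 * s + + 1) + + 18 * (+ 0 * + 0) ≡ (+ 3 * s + + 1) * (+ 3 * s + + 1)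
    drop = solve-∀
    flip : ∀ s t → (+ 3 * s + + 1) * (+ 3 * s + + 1) + + 18 * (- t * - t)
                 ≡ (+ 3 * s + + 1) * (+ 3 * s + + 1) + + 18 * (t * t)
    flip = solve-∀
    norm : ∀ s t → + 3 * ((s - + 2 * t) * (s - + 2 * t)) + + 2 * (s - + 2 * t)
             + + 6 * ((s + t) * (s + t)) + + 4 * (s + t) + + 1
           ≡ (+ 3 * s + + 1) * (+ 3 * s + + 1) + + 18 * (t * t)
    norm = solve-∀
    φρ₁ : ∀ i j k → i + + 2 * (k - i * i - + 2 * (j * j) - i - j)
                    - + 2 * (k - i * i - + 2 * (j * j) - i - j) ≡ i
    φρ₁ = solve-∀
    φρ₂ : ∀ i j k → i + + 2 * (k - i * i - + 2 * (j * j) - i - j) + (k - i * i - + 2 * (j * j) - i - j)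
           ≡ j + - (+ 1) * (+ 3 * (i * i) + + 2 * i + + 6 * (j * j) + + 4 * j + + 1 - (+ 3 * k + + 1))
    φρ₂ = solve-∀
    ρφ₁ : ∀ s t k → + 3 * (s - + 2 * t + + 2 * (k - (s - + 2 * t) * (s - + 2 * t)
                      - + 2 * ((s + t) * (s + t)) - (s - + 2 * t) - (s + t)))
           ≡ + 3 * s + - (+ 2) * ((+ 3 * s + + 1) * (+ 3 * s + + 1) + + 18 * (t * t) - (+ 3 * k + + 1))
    ρφ₁ = solve-∀
    ρφ₂ : ∀ s t k → + 3 * (k - (s - + 2 * t) * (s - + 2 * t)
                      - + 2 * ((s + t) * (s + t)) - (s - + 2 * t) - (s + t))
           ≡ + 3 * t + - (+ 1) * ((+ 3 * s + + 1) * (+ 3 * s + + 1) + + 18 * (t * t) - (+ 3 * k + + 1))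
    ρφ₂ = solve-∀

  -- For norm 2 modulo 3 the quotient by 1 + √-2 is 3s + (3t+1)√-2, and it is s that can change
  -- sign.
  core-2mod3 : ∀ k → HasParity (CoreSet (+ 3 * k + + 2)) p →
               HasParity (λ t → + 2 * ((+ 3 * t + + 1) * (+ 3 * t + + 1)) ≡ + 3 * k + + 2) p
  core-2mod3 k E = parity-cong (λ {t} H → trans (sym (drop t)) H) (λ {t} H → trans (drop t) H)
    (fold-first {P = λ (s , t) → + 9 * (s * s) + + 2 * ((+ 3 * t + + 1) * (+ 3 * t + + 1)) ≡ + 3 * k + + 2}
      (λ {s} {t} H → trans (flip s t) H)
    (parity-substitute φ ρ
      (λ { {i , j} H → cong₂ _,_ (φρ₁ i j k) (combine (- (+ 1)) H (φρ₂ i j k)) })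
      (λ { {s , t} H → cong₂ _,_
        (ℤ.*-cancelˡ-≡ (+ 3) _ s (combine (- (+ 2)) H (ρφ₁ s t k)))
        (ℤ.*-cancelˡ-≡ (+ 3) _ t (combine (- (+ 1)) H (ρφ₂ s t k))) })
      (λ { {s , t} H → trans (norm s t) H })
      (λ { {s , t} H → trans (sym (norm s t)) H }) E))
    where
    φ ρ : ℤ × ℤ → ℤ × ℤ
    φ (s , t) = s - + 2 * t - + 1 , s + t
    -- On solutions the second entry is t = (j - i - 1)/3.
    ρ (i , j) = i + + 2 * (k - i * i - + 2 * (j * j) - i - j) + + 1 , k - i * i - + 2 * (j * j) - i - j
    drop : ∀ t → + 9 * (+ 0 * + 0) + + 2 * ((+ 3 * t + + 1) * (+ 3 * t + + 1))
               ≡ + 2 * ((+ 3 * t + + 1) * (+ 3 * t + + 1))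
    drop = solve-∀
    flip : ∀ s t → + 9 * (- s * - s) + + 2 * ((+ 3 * t + + 1) * (+ 3 * t + + 1))
                 ≡ + 9 * (s * s) + + 2 * ((+ 3 * t + + 1) * (+ 3 * t + + 1))
    flip = solve-∀
    norm : ∀ s t → + 3 * ((s - + 2 * t - + 1) * (s - + 2 * t - + 1)) + + 2 * (s - + 2 * t - + 1)
             + + 6 * ((s + t) * (s + t)) + + 4 * (s + t) + + 1
           ≡ + 9 * (s * s) + + 2 * ((+ 3 * t + + 1) * (+ 3 * t + + 1))
    norm = solve-∀
    φρ₁ : ∀ i j k → i + + 2 * (k - i * i - + 2 * (j * j) - i - j) + + 1
                    - + 2 * (k - i * i - + 2 * (j * j) - i - j) - + 1 ≡ i
    φρ₁ = solve-∀
    φρ₂ : ∀ i j k → i + + 2 * (k - i * i - + 2 * (j * j) - i - j) + + 1 + (k - i * i - + 2 * (j * j) - i - j)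
           ≡ j + - (+ 1) * (+ 3 * (i * i) + + 2 * i + + 6 * (j * j) + + 4 * j + + 1 - (+ 3 * k + + 2))
    φρ₂ = solve-∀
    ρφ₁ : ∀ s t k → + 3 * (s - + 2 * t - + 1 + + 2 * (k - (s - + 2 * t - + 1) * (s - + 2 * t - + 1)
                      - + 2 * ((s + t) * (s + t)) - (s - + 2 * t - + 1) - (s + t)) + + 1)
           ≡ + 3 * s + - (+ 2) * (+ 9 * (s * s) + + 2 * ((+ 3 * t + + 1) * (+ 3 * t + + 1)) - (+ 3 * k + + 2))
    ρφ₁ = solve-∀
    ρφ₂ : ∀ s t k → + 3 * (k - (s - + 2 * t - + 1) * (s - + 2 * t - + 1)
                      - + 2 * ((s + t) * (s + t)) - (s - + 2 * t - + 1) - (s + t))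
           ≡ + 3 * t + - (+ 1) * (+ 9 * (s * s) + + 2 * ((+ 3 * t + + 1) * (+ 3 * t + + 1)) - (+ 3 * k + + 2))
    ρφ₂ = solve-∀

  _≡±_ : ℤ → ℤ → Set
  x ≡± y = x ≡ y ⊎ x ≡ - y

  ≡±-square : ∀ {x y} → x ≡± y → x * x ≡ y * y
  ≡±-square     (inj₁ refl) = refl
  ≡±-square {y = y} (inj₂ refl) = neg-square y
    where
    neg-square : ∀ y → - y * - y ≡ y * y
    neg-square = solve-∀

  cancel-root : ∀ u u′ → + 4 * u + + 1 ≡ + 4 * u′ + + 1 → u ≡ u′
  cancel-root u u′ e = ℤ.*-cancelˡ-≡ (+ 4) u u′ (combine (+ 1) e (step u u′))
    where
    step : ∀ u u′ → + 4 * u ≡ + 4 * u′ + + 1 * (+ 4 * u + + 1 - (+ 4 * u′ + + 1))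
    step = solve-∀

  opposite-roots : ∀ u u′ → ¬ + 4 * u + + 1 ≡ - (+ 4 * u′ + + 1)
  opposite-roots u u′ e = incongruent 4 2 u (- u′ - + 1) (combine (+ 1) e (step u u′))
    where
    step : ∀ u u′ → + 4 * u ≡ + 4 * (- u′ - + 1) + + 2 + + 1 * (+ 4 * u + + 1 - - (+ 4 * u′ + + 1))
    step = solve-∀

  -- Of ± x exactly one is 1 modulo 3, and exactly one is 1 modulo 4.
  normalise-root : ∀ k → HasParity (λ s → (+ 3 * s + + 1) * (+ 3 * s + + 1) ≡ + 3 * (+ 8 * k) + + 1) p →
                   HasParity (λ u → (+ 4 * u + + 1) * (+ 4 * u + + 1) ≡ + 3 * (+ 8 * k) + + 1) p
  normalise-root k = transport (record
    { Related    = λ s u → (+ 3 * s + + 1) ≡± (+ 4 * u + + 1)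
    ; to         = λ {s} H → let u , r = to s H in u , trans (sym (≡±-square r)) H , r
    ; from       = λ {u} H → let s , r = from u H in s , trans (≡±-square r) H , r
    ; injective  = λ {s} {s′} {u} _ _ → injective s s′ u
    ; functional = λ {s} {u} {u′} _ _ → functional s u u′
    })
    where
    to : ∀ s → (+ 3 * s + + 1) * (+ 3 * s + + 1) ≡ + 3 * (+ 8 * k) + + 1 →
         ∃ λ u → (+ 3 * s + + 1) ≡± (+ 4 * u + + 1)
    to s H with residue 4 s
    ... | 0 , _ , t , refl = + 3 * t , inj₁ (step t)
      where
      step : ∀ t → + 3 * (+ 4 * t + + 0) + + 1 ≡ + 4 * (+ 3 * t) + + 1
      step = solve-∀
    ... | 1 , _ , t , refl = ⊥-elim (incongruent 2 1 (+ 8 * ((+ 3 * t + + 1) * (+ 3 * t + + 1))) (+ 12 * k)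
                               (combine (+ 1) H (step t k)))
      where
      step : ∀ t k → + 2 * (+ 8 * ((+ 3 * t + + 1) * (+ 3 * t + + 1))) ≡ + 2 * (+ 12 * k) + + 1 + + 1 *
             ((+ 3 * (+ 4 * t + + 1) + + 1) * (+ 3 * (+ 4 * t + + 1) + + 1) - (+ 3 * (+ 8 * k) + + 1))
      step = solve-∀
    ... | 2 , _ , t , refl = - (+ 3 * t + + 2) , inj₂ (step t)
      where
      step : ∀ t → + 3 * (+ 4 * t + + 2) + + 1 ≡ - (+ 4 * (- (+ 3 * t + + 2)) + + 1)
      step = solve-∀
    ... | 3 , _ , t , refl = ⊥-elim (incongruent 2 1 (+ 2 * ((+ 6 * t + + 5) * (+ 6 * t + + 5))) (+ 12 * k)
                               (combine (+ 1) H (step t k)))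
      where
      step : ∀ t k → + 2 * (+ 2 * ((+ 6 * t + + 5) * (+ 6 * t + + 5))) ≡ + 2 * (+ 12 * k) + + 1 + + 1 *
             ((+ 3 * (+ 4 * t + + 3) + + 1) * (+ 3 * (+ 4 * t + + 3) + + 1) - (+ 3 * (+ 8 * k) + + 1))
      step = solve-∀
    ... | suc (suc (suc (suc _))) , s≤s (s≤s (s≤s (s≤s ()))) , _

    from : ∀ u → (+ 4 * u + + 1) * (+ 4 * u + + 1) ≡ + 3 * (+ 8 * k) + + 1 →
           ∃ λ s → (+ 3 * s + + 1) ≡± (+ 4 * u + + 1)
    from u H with residue 3 u
    ... | 0 , _ , t , refl = + 4 * t , inj₁ (step t)
      where
      step : ∀ t → + 3 * (+ 4 * t) + + 1 ≡ + 4 * (+ 3 * t + + 0) + + 1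
      step = solve-∀
    ... | 1 , _ , t , refl = - (+ 4 * t + + 2) , inj₂ (step t)
      where
      step : ∀ t → + 3 * (- (+ 4 * t + + 2)) + + 1 ≡ - (+ 4 * (+ 3 * t + + 1) + + 1)
      step = solve-∀
    ... | 2 , _ , t , refl = ⊥-elim (incongruent 3 1 (+ 3 * ((+ 4 * t + + 3) * (+ 4 * t + + 3))) (+ 8 * k)
                               (combine (+ 1) H (step t k)))
      where
      step : ∀ t k → + 3 * (+ 3 * ((+ 4 * t + + 3) * (+ 4 * t + + 3))) ≡ + 3 * (+ 8 * k) + + 1 + + 1 *
             ((+ 4 * (+ 3 * t + + 2) + + 1) * (+ 4 * (+ 3 * t + + 2) + + 1) - (+ 3 * (+ 8 * k) + + 1))
      step = solve-∀
    ... | suc (suc (suc _)) , s≤s (s≤s (s≤s ())) , _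

    same : ∀ s s′ {c} → + 3 * s + + 1 ≡ c → + 3 * s′ + + 1 ≡ c → s ≡ s′
    same s s′ e e′ = ℤ.*-cancelˡ-≡ (+ 3) s s′ (combine (+ 1) (trans e (sym e′)) (step s s′))
      where
      step : ∀ s s′ → + 3 * s ≡ + 3 * s′ + + 1 * (+ 3 * s + + 1 - (+ 3 * s′ + + 1))
      step = solve-∀
    opposite : ∀ s s′ {c} → + 3 * s + + 1 ≡ c → + 3 * s′ + + 1 ≡ - c → s ≡ s′
    opposite s s′ {c} e e′ = ⊥-elim (incongruent 3 1 s (- s′ - + 1)
      (combine (+ 1) (trans e (trans (sym (ℤ.neg-involutive c)) (cong (-_) (sym e′)))) (step s s′)))
      where
      step : ∀ s s′ → + 3 * s ≡ + 3 * (- s′ - + 1) + + 1 + + 1 * (+ 3 * s + + 1 - - (+ 3 * s′ + + 1))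
      step = solve-∀

    injective : ∀ s s′ u → (+ 3 * s + + 1) ≡± (+ 4 * u + + 1) →
                (+ 3 * s′ + + 1) ≡± (+ 4 * u + + 1) → s ≡ s′
    injective s s′ u (inj₁ e) (inj₁ e′) = same s s′ e e′
    injective s s′ u (inj₁ e) (inj₂ e′) = opposite s s′ e e′
    injective s s′ u (inj₂ e) (inj₁ e′) = sym (opposite s′ s e′ e)
    injective s s′ u (inj₂ e) (inj₂ e′) = same s s′ e e′

    functional : ∀ s u u′ → (+ 3 * s + + 1) ≡± (+ 4 * u + + 1) →
                 (+ 3 * s + + 1) ≡± (+ 4 * u′ + + 1) → u ≡ u′
    functional s u u′ (inj₁ e) (inj₁ e′) = cancel-root u u′ (trans (sym e) e′)
    functional s u u′ (inj₁ e) (inj₂ e′) = ⊥-elim (opposite-roots u u′ (trans (sym e) e′))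
    functional s u u′ (inj₂ e) (inj₁ e′) = ⊥-elim (opposite-roots u′ u (trans (sym e′) e))
    functional s u u′ (inj₂ e) (inj₂ e′) = cancel-root u u′ (ℤ.neg-injective (trans (sym e) e′))

-- Descent by the factor 3, and the products f₁³ and f₁ψ.

module PentagonalProducts where

  open Counting
  open import Data.Empty using (⊥-elim)
  open import Data.Fin.Base using (zero; suc)
  open import Data.Integer.Base using (ℤ; +_; _+_; _-_; _*_; -_)
  import Data.Integer.Properties as ℤ
  open import Data.Integer.Tactic.RingSolver using (solve-∀)
  open import Data.Nat.Base as ℕ using (ℕ; suc; s≤s)
  open import Data.Nat.DivMod using (_divMod_; result)
  open import Data.Nat.Induction using (<-rec)
  import Data.Nat.Properties as ℕ
  open import Data.Parity.Base using (Parity)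
  open import Data.Product.Base using (∃; _×_; _,_; proj₁; proj₂)
  open Integers
  open Pentagonal using (pentagonal)
  open import Relation.Binary.PropositionalEquality
    using (_≡_; refl; sym; trans; cong; cong₂; subst)
  open Series
  open SqrtMinusTwo
  open Theta

  private
    variable
      p : Parity

  Square : ℤ → ℤ → Set
  Square m u = (+ 4 * u + + 1) * (+ 4 * u + + 1) ≡ m

  TripleSquare : ℤ → ℤ → Set
  TripleSquare m u = + 3 * ((+ 4 * u + + 1) * (+ 4 * u + + 1)) ≡ m

  -- The solutions of `core i j = 8n + 1` have both entries even, and (2x, 2y) stands for
  -- `pentagonal x + 2 pentagonal y = n`; hence they are counted by f₁³. The parity p stays
  -- arbitrary because it is only passed along.
  CoreSquare : ℕ → Set
  CoreSquare n = ∀ {p} → HasParity (CoreSet (+ 8 * + n + + 1)) p → HasParity (Square (+ 8 * + n + + 1)) p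

  -- Here the solutions are (2x, -(2y+1)) with `pentagonal x + octagonal y = n`. Division by 3
  -- exchanges the classes 1 and 3 modulo 8, which ties this claim to `CoreSquare`.
  CoreTripleSquare : ℕ → Set
  CoreTripleSquare n = ∀ {p} → HasParity (CoreSet (+ 8 * + n + + 3)) p →
                       HasParity (TripleSquare (+ 8 * + n + + 3)) p

  private
    at : ∀ {m m′} (P : ℤ → ℤ × ℤ → Set) → m ≡ m′ → HasParity (P m) p → HasParity (P m′) p
    at P eq = subst (λ m → HasParity (P m) _) eq

    at₁ : ∀ {m m′} (P : ℤ → ℤ → Set) → m ≡ m′ → HasParity (P m) p → HasParity (P m′) p
    at₁ P eq = subst (λ m → HasParity (P m) _) eq

    linear : ∀ r q c → + 8 * + (r ℕ.+ q ℕ.* 3) + c ≡ + 8 * (+ r + + 3 * + q) + c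
    linear r q c = cong (λ z → + 8 * (+ r + z) + c) (trans (ℤ.pos-* q 3) (ℤ.*-comm (+ q) (+ 3)))

    -- A square divisible by 3 has its root divisible by 3, and 4x + 1 = -3(4u + 1) for x = -(3u +
    -- 1).
    triple : ∀ k → HasParity (TripleSquare (+ 8 * k + + 3)) p →
             HasParity (Square (+ 3 * (+ 8 * k + + 3))) p
    triple k = pushforward (λ u → - (+ 3 * u + + 1))
      (λ {u} {u′} _ _ e → ℤ.*-cancelˡ-≡ (+ 3) u u′ (combine (- (+ 1)) e (injective u u′)))
      (λ {u} H → trans (square u) (cong (+ 3 *_) H))
      (λ {x} → onto x)
      where
      injective : ∀ u u′ → + 3 * u ≡ + 3 * u′ + - (+ 1) * (- (+ 3 * u + + 1) - - (+ 3 * u′ + + 1))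
      injective = solve-∀
      square : ∀ u → (+ 4 * - (+ 3 * u + + 1) + + 1) * (+ 4 * - (+ 3 * u + + 1) + + 1) ≡
                     + 3 * (+ 3 * ((+ 4 * u + + 1) * (+ 4 * u + + 1)))
      square = solve-∀
      onto : ∀ x → Square (+ 3 * (+ 8 * k + + 3)) x →
             ∃ λ u → TripleSquare (+ 8 * k + + 3) u × - (+ 3 * u + + 1) ≡ x
      onto x H with residue 3 x
      ... | 0 , _ , t , refl = ⊥-elim (incongruent 3 1 (+ 8 * k + + 3) (+ 48 * (t * t) + + 8 * t)
                                 (combine (- (+ 1)) H (step t k)))
        where
        step : ∀ t k → + 3 * (+ 8 * k + + 3) ≡ + 3 * (+ 48 * (t * t) + + 8 * t) + + 1 + - (+ 1) *
               ((+ 4 * (+ 3 * t + + 0) + + 1) * (+ 4 * (+ 3 * t + + 0) + + 1) - + 3 * (+ 8 * k + + 3))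
        step = solve-∀
      ... | 1 , _ , t , refl = ⊥-elim (incongruent 3 1 (+ 8 * k + + 3) (+ 48 * (t * t) + + 40 * t + + 8)
                                 (combine (- (+ 1)) H (step t k)))
        where
        step : ∀ t k → + 3 * (+ 8 * k + + 3) ≡ + 3 * (+ 48 * (t * t) + + 40 * t + + 8) + + 1 + - (+ 1) *
               ((+ 4 * (+ 3 * t + + 1) + + 1) * (+ 4 * (+ 3 * t + + 1) + + 1) - + 3 * (+ 8 * k + + 3))
        step = solve-∀
      ... | 2 , _ , t , refl = - (t + + 1) ,
          ℤ.*-cancelˡ-≡ (+ 3) _ (+ 8 * k + + 3) (trans (step t) H) , preimage t
        where
        step : ∀ t → + 3 * (+ 3 * ((+ 4 * - (t + + 1) + + 1) * (+ 4 * - (t + + 1) + + 1))) ≡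
                     (+ 4 * (+ 3 * t + + 2) + + 1) * (+ 4 * (+ 3 * t + + 2) + + 1)
        step = solve-∀
        preimage : ∀ t → - (+ 3 * - (t + + 1) + + 1) ≡ + 3 * t + + 2
        preimage = solve-∀
      ... | suc (suc (suc _)) , s≤s (s≤s (s≤s ())) , _

  -- The claim for squares enters as a hypothesis on n/3 only, so that a well-founded recursion can
  -- supply it. If 3 does not divide n, then 8n + 3 is not divisible by 3 either; the folded set and
  -- the set of triple squares are both empty.
  coreTripleSquare-from : ∀ n → (∀ q → n ≡ q ℕ.* 3 → CoreSquare q) → CoreTripleSquare n
  coreTripleSquare-from n rec E with n divMod 3
  ... | result q zero refl =
    parity-cong (λ H → trans (cong (+ 3 *_) H) (sym m≡)) (λ H → ℤ.*-cancelˡ-≡ (+ 3) _ _ (trans H m≡))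
      (rec q refl (core-descent (+ 8 * + q + + 1) (at CoreSet m≡ E)))
    where
    step : ∀ q → + 8 * (+ 0 + + 3 * q) + + 3 ≡ + 3 * (+ 8 * q + + 1)
    step = solve-∀
    m≡ = trans (linear 0 q (+ 3)) (step (+ q))
  ... | result q (suc zero) refl =
    parity-none
      (λ {t} H → incongruent 2 1 _ (+ 12 * + q + + 5) (trans H (odd (+ q))))
      (λ {u} H → incongruent 3 2 _ (+ 8 * + q + + 3) (trans H m≡))
      (core-2mod3 (+ 8 * + q + + 3) (at CoreSet m≡ E))
    where
    step : ∀ q → + 8 * (+ 1 + + 3 * q) + + 3 ≡ + 3 * (+ 8 * q + + 3) + + 2
    step = solve-∀
    m≡ = trans (linear 1 q (+ 3)) (step (+ q))
    odd : ∀ q → + 3 * (+ 8 * q + + 3) + + 2 ≡ + 2 * (+ 12 * q + + 5) + + 1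
    odd = solve-∀
  ... | result q (suc (suc zero)) refl =
    parity-none
      (λ {s} H → square-≢3mod4 (+ 3 * s + + 1) (+ 6 * + q + + 4) (trans H (3mod4 (+ q))))
      (λ {u} H → incongruent 3 1 _ (+ 8 * + q + + 6) (trans H m≡))
      (core-1mod3 (+ 8 * + q + + 6) (at CoreSet m≡ E))
    where
    step : ∀ q → + 8 * (+ 2 + + 3 * q) + + 3 ≡ + 3 * (+ 8 * q + + 6) + + 1
    step = solve-∀
    m≡ = trans (linear 2 q (+ 3)) (step (+ q))
    3mod4 : ∀ q → + 3 * (+ 8 * q + + 6) + + 1 ≡ + 4 * (+ 6 * q + + 4) + + 3
    3mod4 = solve-∀

  -- If 3 divides 8n + 1, descend. Otherwise the fold leaves the square itself for remainder 1, and
  -- for remainder 2 both sides are empty.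
  coreSquare : ∀ n → CoreSquare n
  coreSquare = <-rec CoreSquare body
    where
    body : ∀ n → (∀ {m} → m ℕ.< n → CoreSquare m) → CoreSquare n
    body n rec E with n divMod 3
    ... | result q zero refl =
      at₁ Square (sym m≡) (normalise-root (+ q) (core-1mod3 (+ 8 * + q) (at CoreSet m≡ E)))
      where
      step : ∀ q → + 8 * (+ 0 + + 3 * q) + + 1 ≡ + 3 * (+ 8 * q) + + 1
      step = solve-∀
      m≡ = trans (linear 0 q (+ 1)) (step (+ q))
    ... | result q (suc zero) refl =
      at₁ Square (sym m≡) (triple (+ q) (coreTripleSquare-from q
        -- Now n = 9r + 1 and 8n + 1 = 9(8r + 1): two descents return to the class 1 modulo 8 with r
        -- < n.
        (λ { r refl → rec (s≤s (ℕ.≤-trans (ℕ.m≤m*n r 3) (ℕ.m≤m*n (r ℕ.* 3) 3))) })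
        (core-descent (+ 8 * + q + + 3) (at CoreSet m≡ E))))
      where
      step : ∀ q → + 8 * (+ 1 + + 3 * q) + + 1 ≡ + 3 * (+ 8 * q + + 3)
      step = solve-∀
      m≡ = trans (linear 1 q (+ 1)) (step (+ q))
    ... | result q (suc (suc zero)) refl =
      parity-none
        (λ {t} H → incongruent 2 1 _ (+ 12 * + q + + 8) (trans H (odd (+ q))))
        (λ {u} H → square-≢2mod3 (+ 4 * u + + 1) (+ 8 * + q + + 5) (trans H m≡))
        (core-2mod3 (+ 8 * + q + + 5) (at CoreSet m≡ E))
      where
      step : ∀ q → + 8 * (+ 2 + + 3 * q) + + 1 ≡ + 3 * (+ 8 * q + + 5) + + 2
      step = solve-∀
      m≡ = trans (linear 2 q (+ 1)) (step (+ q))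
      odd : ∀ q → + 3 * (+ 8 * q + + 5) + + 2 ≡ + 2 * (+ 12 * q + + 8) + + 1
      odd = solve-∀

  coreTripleSquare : ∀ n → CoreTripleSquare n
  coreTripleSquare n = coreTripleSquare-from n (λ q _ → coreSquare q)

  8*-cancel : ∀ c {m n} → + 8 * + m + c ≡ + 8 * + n + c → m ≡ n
  8*-cancel = cancel 8

  private
    double-injective : ∀ x x′ → + 2 * x ≡ + 2 * x′ → x ≡ x′
    double-injective x x′ = ℤ.*-cancelˡ-≡ (+ 2) x x′

  -- f₁f₂ = f₁³ counts triangular numbers.
  pentagonal-cube : ∀ {f} → Graded f pentagonal → Graded (f ⊛ (f ⊛ f)) triangularℤ
  pentagonal-cube {f} F n = parity-cong
    (λ {u} H → 8*-cancel (+ 1) (trans (sym (square u)) H))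
    (λ { {u} refl → square u })
    (coreSquare n (pushforward (λ (x , y) → + 2 * x , + 2 * y)
      (λ { {x , y} {x′ , y′} _ _ e → cong₂ _,_ (double-injective x x′ (cong proj₁ e))
                                              (double-injective y y′ (cong proj₂ e)) })
      (λ { {x , y} refl → core-value x y })
      (λ { {i , j} → onto i j })
      (graded-⊛ F (graded-square F) n)))
    where
    square : ∀ u → (+ 4 * u + + 1) * (+ 4 * u + + 1) ≡ + 8 * + triangularℤ u + + 1
    square u = trans (step u) (cong (λ z → + 8 * z + + 1) (sym (pos-triangularℤ u)))
      where
      step : ∀ u → (+ 4 * u + + 1) * (+ 4 * u + + 1) ≡ + 8 * (u * (+ 2 * u + + 1)) + + 1
      step = solve-∀

    core-value : ∀ x y → core (+ 2 * x) (+ 2 * y) ≡ + 8 * + (pentagonal x ℕ.+ 2 ℕ.* pentagonal y) + + 1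
    core-value x y = trans (step x y) (trans
      (cong₂ (λ a b → + 4 * a + + 8 * b + + 1) (sym (2*pentagonal x)) (sym (2*pentagonal y)))
      (trans (regroup (+ pentagonal x) (+ pentagonal y))
        (cong (λ z → + 8 * (+ pentagonal x + z) + + 1) (sym (ℤ.pos-* 2 (pentagonal y))))))
      where
      step : ∀ x y → + 3 * ((+ 2 * x) * (+ 2 * x)) + + 2 * (+ 2 * x) + + 6 * ((+ 2 * y) * (+ 2 * y))
               + + 4 * (+ 2 * y) + + 1 ≡ + 4 * (x * (+ 3 * x + + 1)) + + 8 * (y * (+ 3 * y + + 1)) + + 1
      step = solve-∀
      regroup : ∀ a b → + 4 * (+ 2 * a) + + 8 * (+ 2 * b) + + 1 ≡ + 8 * (a + + 2 * b) + + 1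
      regroup = solve-∀

    i-even : ∀ i j n → i * i ≡ + 2 * (+ 4 * n - i * i - i - + 3 * (j * j) - + 2 * j) + + 1 *
      (+ 3 * (i * i) + + 2 * i + + 6 * (j * j) + + 4 * j + + 1 - (+ 8 * n + + 1))
    i-even = solve-∀
    j-even : ∀ x j n → + 2 * (j * j) ≡ + 2 * (+ 2 * (+ 2 * n - + 3 * (x * x) - x - j - j * j)) + + 1 *
      (+ 3 * ((+ 2 * x) * (+ 2 * x)) + + 2 * (+ 2 * x) + + 6 * (j * j) + + 4 * j + + 1 - (+ 8 * n + + 1))
    j-even = solve-∀

    onto : ∀ i j → core i j ≡ + 8 * + n + + 1 →
           ∃ λ ((x , y) : ℤ × ℤ) → pentagonal x ℕ.+ 2 ℕ.* pentagonal y ≡ n × (+ 2 * x , + 2 * y) ≡ (i , j)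
    onto i j H
      with x , refl ← even-square i (+ 4 * + n - i * i - i - + 3 * (j * j) - + 2 * j)
             (combine (+ 1) H (i-even i j (+ n)))
      with y , refl ← even-square j (+ 2 * + n - + 3 * (x * x) - x - j - j * j)
             (ℤ.*-cancelˡ-≡ (+ 2) _ (+ 2 * (+ 2 * + n - + 3 * (x * x) - x - j - j * j))
               (combine (+ 1) H (j-even x j (+ n))))
      = (x , y) , 8*-cancel (+ 1) (trans (sym (core-value x y)) H) , refl

  -- g is f₃³/f₁.
  pentagonal-⊛-octagonal : ∀ {f g} → Graded f pentagonal → Graded g octagonal →
                           Graded (f ⊛ g) (λ u → 3 ℕ.* triangularℤ u)
  pentagonal-⊛-octagonal F G n = parity-cong
    (λ {u} H → 8*-cancel (+ 3) (trans (sym (square u)) H))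
    (λ { {u} refl → square u })
    (coreTripleSquare n (pushforward (λ (x , y) → + 2 * x , - (+ 2 * y + + 1))
      (λ { {x , y} {x′ , y′} _ _ e → cong₂ _,_ (double-injective x x′ (cong proj₁ e))
        (double-injective y y′ (combine (- (+ 1)) (cong proj₂ e) (injective y y′))) })
      (λ { {x , y} refl → core-value x y })
      (λ { {i , j} → onto i j })
      (graded-⊛ F G n)))
    where
    injective : ∀ y y′ → + 2 * y ≡ + 2 * y′ + - (+ 1) * (- (+ 2 * y + + 1) - - (+ 2 * y′ + + 1))
    injective = solve-∀

    square : ∀ u → + 3 * ((+ 4 * u + + 1) * (+ 4 * u + + 1)) ≡ + 8 * + (3 ℕ.* triangularℤ u) + + 3
    square u = trans (step u) (cong (λ z → + 8 * z + + 3)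
      (trans (cong (+ 3 *_) (sym (pos-triangularℤ u))) (sym (ℤ.pos-* 3 (triangularℤ u)))))
      where
      step : ∀ u → + 3 * ((+ 4 * u + + 1) * (+ 4 * u + + 1)) ≡ + 8 * (+ 3 * (u * (+ 2 * u + + 1))) + + 3
      step = solve-∀

    core-value : ∀ x y → core (+ 2 * x) (- (+ 2 * y + + 1)) ≡
                         + 8 * + (pentagonal x ℕ.+ octagonal y) + + 3
    core-value x y = trans (step x y) (trans
      (cong₂ (λ a b → + 4 * a + + 8 * b + + 3) (sym (2*pentagonal x)) (sym (pos-octagonal y)))
      (regroup (+ pentagonal x) (+ octagonal y)))
      where
      step : ∀ x y → + 3 * ((+ 2 * x) * (+ 2 * x)) + + 2 * (+ 2 * x)
               + + 6 * (- (+ 2 * y + + 1) * - (+ 2 * y + + 1)) + + 4 * - (+ 2 * y + + 1) + + 1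
               ≡ + 4 * (x * (+ 3 * x + + 1)) + + 8 * (y * (+ 3 * y + + 2)) + + 3
      step = solve-∀
      regroup : ∀ a b → + 4 * (+ 2 * a) + + 8 * b + + 3 ≡ + 8 * (a + b) + + 3
      regroup = solve-∀

    i-even : ∀ i j n → i * i ≡ + 2 * (+ 4 * n + + 1 - i * i - i - + 3 * (j * j) - + 2 * j) + + 1 *
      (+ 3 * (i * i) + + 2 * i + + 6 * (j * j) + + 4 * j + + 1 - (+ 8 * n + + 3))
    i-even = solve-∀

    onto : ∀ i j → core i j ≡ + 8 * + n + + 3 →
           ∃ λ ((x , y) : ℤ × ℤ) → pentagonal x ℕ.+ octagonal y ≡ n × (+ 2 * x , - (+ 2 * y + + 1)) ≡ (i , j)
    onto i j H
      with x , refl ← even-square i (+ 4 * + n + + 1 - i * i - i - + 3 * (j * j) - + 2 * j)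
             (combine (+ 1) H (i-even i j (+ n)))
      with residue 2 j
    ... | 0 , _ , t , refl = ⊥-elim (incongruent 4 2 (+ 3 * (x * x) + x + + 6 * (t * t) + + 2 * t) (+ 2 * + n)
                               (combine (+ 1) H (step x t (+ n))))
      where
      step : ∀ x t n → + 4 * (+ 3 * (x * x) + x + + 6 * (t * t) + + 2 * t) ≡ + 4 * (+ 2 * n) + + 2 + + 1 *
        (+ 3 * ((+ 2 * x) * (+ 2 * x)) + + 2 * (+ 2 * x) + + 6 * ((+ 2 * t + + 0) * (+ 2 * t + + 0))
          + + 4 * (+ 2 * t + + 0) + + 1 - (+ 8 * n + + 3))
      step = solve-∀
    ... | 1 , _ , t , refl = (x , - (t + + 1)) ,
        8*-cancel (+ 3) (trans (sym (core-value x (- (t + + 1)))) (trans (cong (core (+ 2 * x)) (preimage t)) H)) ,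
        cong (+ 2 * x ,_) (preimage t)
      where
      preimage : ∀ t → - (+ 2 * - (t + + 1) + + 1) ≡ + 2 * t + + 1
      preimage = solve-∀
    ... | suc (suc _) , s≤s (s≤s ()) , _

-- The exponents 4n + 1 in f₁³ f₂₁, through x² + 7y².

module SqrtMinusSeven where

  open Counting
  open import Data.Empty using (⊥-elim)
  open import Data.Integer.Base using (ℤ; +_; _+_; _-_; _*_; -_)
  import Data.Integer.Properties as ℤ
  open import Data.Integer.Tactic.RingSolver using (solve-∀)
  open import Data.Nat.Base as ℕ using (ℕ; suc; s≤s)
  open import Data.Product.Base using (∃; _×_; _,_; proj₁; proj₂)
  open import Data.Sum.Base using (inj₁; inj₂)
  open Integers
  open Pentagonal using (pentagonal)
  open import Relation.Binary.PropositionalEquality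
    using (_≡_; refl; sym; trans; cong; cong₂)
  open Series
  open SqrtMinusTwo using (_≡±_; ≡±-square; cancel-root; opposite-roots)
  open Theta

  -- The norm of a - r√-7 with a = 6j + 1 - 3r. Its product with -3 + √-7, of norm 16, is (16r - 18j
  -- - 3) + (6j + 1)√-7.
  reducedForm : ℤ → ℤ → ℤ
  reducedForm r j = (+ 6 * j + + 1 - + 3 * r) * (+ 6 * j + + 1 - + 3 * r) + + 7 * (r * r)

  module _ (n : ℕ) where

    InS : ℤ × ℤ → Set
    InS (i , j) = triangularℤ i ℕ.+ 21 ℕ.* pentagonal j ≡ 4 ℕ.* n ℕ.+ 1

    -- A solution of u² + 7v² = 16(2n+1) with u = 4i+1 and v = 6j+1 satisfies u ≡ ± 3v (mod 16),
    -- and then u = ± (16r - 3v) with (v - 3r)² + 7r² = 2n+1.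
    Reduced : ℤ × ℤ → Set
    Reduced (r , j) = reducedForm r j ≡ + 2 * + n + + 1

    private
      norm : ∀ i j → (+ 4 * i + + 1) * (+ 4 * i + + 1) + + 7 * ((+ 6 * j + + 1) * (+ 6 * j + + 1)) ≡
                     + 8 * + (triangularℤ i ℕ.+ 21 ℕ.* pentagonal j) + + 8
      norm i j = trans (step i j) (trans
        (cong₂ (λ a b → + 8 * a + + 84 * b + + 8) (sym (pos-triangularℤ i)) (sym (2*pentagonal j)))
        (trans (regroup (+ triangularℤ i) (+ pentagonal j))
          (cong (λ z → + 8 * (+ triangularℤ i + z) + + 8) (sym (ℤ.pos-* 21 (pentagonal j))))))
        where
        step : ∀ i j → (+ 4 * i + + 1) * (+ 4 * i + + 1) + + 7 * ((+ 6 * j + + 1) * (+ 6 * j + + 1)) ≡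
                       + 8 * (i * (+ 2 * i + + 1)) + + 84 * (j * (+ 3 * j + + 1)) + + 8
        step = solve-∀
        regroup : ∀ a b → + 8 * a + + 84 * (+ 2 * b) + + 8 ≡ + 8 * (a + + 21 * b) + + 8
        regroup = solve-∀

      pos-4n+1 : + (4 ℕ.* n ℕ.+ 1) ≡ + 4 * + n + + 1
      pos-4n+1 = cong (λ z → z + + 1) (ℤ.pos-* 4 n)

      norm-S : ∀ i j → InS (i , j) → (+ 4 * i + + 1) * (+ 4 * i + + 1) + + 7 * ((+ 6 * j + + 1) * (+ 6 * j + + 1)) ≡
               + 16 * (+ 2 * + n + + 1)
      norm-S i j S = trans (norm i j) (trans (cong (λ z → + 8 * + z + + 8) S)
        (trans (cong (λ z → + 8 * z + + 8) pos-4n+1) (step (+ n))))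
        where
        step : ∀ n → + 8 * (+ 4 * n + + 1) + + 8 ≡ + 16 * (+ 2 * n + + 1)
        step = solve-∀

      norm-S⁻¹ : ∀ i j → (+ 4 * i + + 1) * (+ 4 * i + + 1) + + 7 * ((+ 6 * j + + 1) * (+ 6 * j + + 1)) ≡
                 + 16 * (+ 2 * + n + + 1) → InS (i , j)
      norm-S⁻¹ i j eq = cancel 8 (+ 8) (trans (sym (norm i j)) (trans eq
        (trans (step (+ n)) (cong (λ z → + 8 * z + + 8) (sym pos-4n+1)))))
        where
        step : ∀ n → + 16 * (+ 2 * n + + 1) ≡ + 8 * (+ 4 * n + + 1) + + 8
        step = solve-∀

      root : ℤ → ℤ → ℤ
      root r j = + 16 * r - + 18 * j - + 3

      norm-root : ∀ r j → root r j * root r j + + 7 * ((+ 6 * j + + 1) * (+ 6 * j + + 1)) ≡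
        + 16 * ((+ 6 * j + + 1 - + 3 * r) * (+ 6 * j + + 1 - + 3 * r) + + 7 * (r * r))
      norm-root = step
        where
        step : ∀ r j → (+ 16 * r - + 18 * j - + 3) * (+ 16 * r - + 18 * j - + 3)
                 + + 7 * ((+ 6 * j + + 1) * (+ 6 * j + + 1)) ≡
               + 16 * ((+ 6 * j + + 1 - + 3 * r) * (+ 6 * j + + 1 - + 3 * r) + + 7 * (r * r))
        step = solve-∀

      norm-± : ∀ i r j → (+ 4 * i + + 1) ≡± root r j →
               (+ 4 * i + + 1) * (+ 4 * i + + 1) + + 7 * ((+ 6 * j + + 1) * (+ 6 * j + + 1)) ≡
               + 16 * ((+ 6 * j + + 1 - + 3 * r) * (+ 6 * j + + 1 - + 3 * r) + + 7 * (r * r))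
      norm-± i r j e = trans (cong (_+ + 7 * ((+ 6 * j + + 1) * (+ 6 * j + + 1))) (≡±-square e)) (norm-root r j)

      -- Both witnesses invert a number modulo 4: with z = i+9h+1 and y = i-9h-5 the hypotheses read
      -- z(2z-3) ≡ 0 and y(2y+21) ≡ 0, where 2z-3 and 2y+21 are odd, hence their own inverses.
      evenRoot oddRoot : ℤ → ℤ → ℤ
      evenRoot z h = (+ 2 * z - + 3) * (+ n + + 9 * h * z - + 72 * (h * h) - + 12 * h)
                     - z * (z * z - + 3 * z + + 2)
      oddRoot y h = y * (y * y + + 21 * y + + 110)
                    - (+ 2 * y + + 21) * (+ n - + 9 * h * y - + 72 * (h * h) - + 84 * h - + 24)

      reduce : ∀ i j → InS (i , j) → ∃ λ r → (+ 4 * i + + 1) ≡± root r j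
      reduce i j S with residue 2 j
      ... | 0 , _ , h , refl = evenRoot (i + + 9 * h + + 1) h , inj₁
          (combine (+ 4 * (+ 2 * (i + + 9 * h + + 1) - + 3))
            (ℤ.*-cancelˡ-≡ (+ 8) (i * (+ 2 * i + + 1) + + 21 * (h * (+ 6 * h + + 1))) (+ 4 * + n + + 1)
              (combine (+ 1) (norm-S i (+ 2 * h + + 0) S) (divide i h (+ n))))
            (solution i h (+ n)))
        where
        divide : ∀ i h n → + 8 * (i * (+ 2 * i + + 1) + + 21 * (h * (+ 6 * h + + 1))) ≡
          + 8 * (+ 4 * n + + 1) + + 1 * ((+ 4 * i + + 1) * (+ 4 * i + + 1)
            + + 7 * ((+ 6 * (+ 2 * h + + 0) + + 1) * (+ 6 * (+ 2 * h + + 0) + + 1)) - + 16 * (+ 2 * n + + 1))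
        divide = solve-∀
        solution : ∀ i h n → let z = i + + 9 * h + + 1 in
          + 4 * i + + 1 ≡ + 16 * ((+ 2 * z - + 3) * (n + + 9 * h * z - + 72 * (h * h) - + 12 * h)
                                  - z * (z * z - + 3 * z + + 2)) - + 18 * (+ 2 * h + + 0) - + 3
            + + 4 * (+ 2 * z - + 3) * (i * (+ 2 * i + + 1) + + 21 * (h * (+ 6 * h + + 1)) - (+ 4 * n + + 1))
        solution = solve-∀
      ... | 1 , _ , h , refl = oddRoot (i - + 9 * h - + 5) h , inj₂
          (combine (+ 4 * (+ 2 * (i - + 9 * h - + 5) + + 21))
            (ℤ.*-cancelˡ-≡ (+ 8) (i * (+ 2 * i + + 1) + + 21 * ((+ 2 * h + + 1) * (+ 3 * h + + 2))) (+ 4 * + n + + 1)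
              (combine (+ 1) (norm-S i (+ 2 * h + + 1) S) (divide i h (+ n))))
            (solution i h (+ n)))
        where
        divide : ∀ i h n → + 8 * (i * (+ 2 * i + + 1) + + 21 * ((+ 2 * h + + 1) * (+ 3 * h + + 2))) ≡
          + 8 * (+ 4 * n + + 1) + + 1 * ((+ 4 * i + + 1) * (+ 4 * i + + 1)
            + + 7 * ((+ 6 * (+ 2 * h + + 1) + + 1) * (+ 6 * (+ 2 * h + + 1) + + 1)) - + 16 * (+ 2 * n + + 1))
        divide = solve-∀
        solution : ∀ i h n → let y = i - + 9 * h - + 5 in
          + 4 * i + + 1 ≡ - (+ 16 * (y * (y * y + + 21 * y + + 110)
              - (+ 2 * y + + 21) * (n - + 9 * h * y - + 72 * (h * h) - + 84 * h - + 24)) - + 18 * (+ 2 * h + + 1) - + 3)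
            + + 4 * (+ 2 * y + + 21) * (i * (+ 2 * i + + 1) + + 21 * ((+ 2 * h + + 1) * (+ 3 * h + + 2)) - (+ 4 * n + + 1))
        solution = solve-∀
      ... | suc (suc _) , s≤s (s≤s ()) , _

      -- Since `root r j` is 2j + 1 modulo 4, the parity of j decides whether it or its negative has
      -- the form 4i + 1.
      expand : ∀ r j → ∃ λ i → (+ 4 * i + + 1) ≡± root r j
      expand r j with residue 2 j
      ... | 0 , _ , h , refl = + 4 * r - + 9 * h - + 1 , inj₁ (step r h)
        where
        step : ∀ r h → + 4 * (+ 4 * r - + 9 * h - + 1) + + 1 ≡ + 16 * r - + 18 * (+ 2 * h + + 0) - + 3
        step = solve-∀
      ... | 1 , _ , h , refl = + 9 * h + + 5 - + 4 * r , inj₂ (step r h)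
        where
        step : ∀ r h → + 4 * (+ 9 * h + + 5 - + 4 * r) + + 1 ≡ - (+ 16 * r - + 18 * (+ 2 * h + + 1) - + 3)
        step = solve-∀
      ... | suc (suc _) , s≤s (s≤s ()) , _

      root-injective : ∀ r r′ j → root r j ≡ root r′ j → r ≡ r′
      root-injective r r′ j e = ℤ.*-cancelˡ-≡ (+ 16) r r′ (combine (+ 1) e (step r r′ j))
        where
        step : ∀ r r′ j → + 16 * r ≡ + 16 * r′ + + 1 *
               ((+ 16 * r - + 18 * j - + 3) - (+ 16 * r′ - + 18 * j - + 3))
        step = solve-∀

      -- The premise is contradictory: both roots are 2j + 1 modulo 4, so their sum is 2 modulo 4.
      root-opposite : ∀ r r′ j → root r j ≡ - root r′ j → r ≡ r′
      root-opposite r r′ j e = ⊥-elim (incongruent 4 2 (+ 4 * (r + r′)) (+ 9 * j + + 1) (combine (+ 1) e (step r r′ j)))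
        where
        step : ∀ r r′ j → + 4 * (+ 4 * (r + r′)) ≡ + 4 * (+ 9 * j + + 1) + + 2 + + 1 *
               ((+ 16 * r - + 18 * j - + 3) - - (+ 16 * r′ - + 18 * j - + 3))
        step = solve-∀

      same-i : ∀ i i′ {x} → (+ 4 * i + + 1) ≡± x → (+ 4 * i′ + + 1) ≡± x → i ≡ i′
      same-i i i′ (inj₁ e) (inj₁ e′) = cancel-root i i′ (trans e (sym e′))
      same-i i i′ (inj₁ refl) (inj₂ e′) = ⊥-elim (opposite-roots i′ i e′)
      same-i i i′ (inj₂ e) (inj₁ refl) = ⊥-elim (opposite-roots i i′ e)
      same-i i i′ (inj₂ e) (inj₂ e′) = cancel-root i i′ (trans e (sym e′))

      same-r : ∀ r r′ j {x} → x ≡± root r j → x ≡± root r′ j → r ≡ r′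
      same-r r r′ j (inj₁ refl) (inj₁ e′) = root-injective r r′ j e′
      same-r r r′ j (inj₁ refl) (inj₂ e′) = root-opposite r r′ j e′
      same-r r r′ j (inj₂ e) (inj₁ refl) = sym (root-opposite r′ r j e)
      same-r r r′ j (inj₂ e) (inj₂ e′) = root-injective r r′ j (ℤ.neg-injective (trans (sym e) e′))

      correspondence : Correspondence InS Reduced
      correspondence = record
        { Related    = λ (i , j) (r , j′) → (+ 4 * i + + 1) ≡± root r j × j ≡ j′
        ; to         = λ { {i , j} S → let r , e = reduce i j S in
                         (r , j) , ℤ.*-cancelˡ-≡ (+ 16) (reducedForm r j) (+ 2 * + n + + 1)
                                     (trans (sym (norm-± i r j e)) (norm-S i j S)) , e , refl }
        ; from       = λ { {r , j} Y → let i , e = expand r j in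
                         (i , j) , norm-S⁻¹ i j (trans (norm-± i r j e) (cong (+ 16 *_) Y)) , e , refl }
        ; injective  = λ { {i , j} {i′ , _} {r , _} _ _ (e , refl) (e′ , refl) → cong (_, j) (same-i i i′ e e′) }
        ; functional = λ { {i , j} {r , _} {r′ , _} _ _ (e , refl) (e′ , refl) → cong (_, j) (same-r r r′ j e e′) }
        }

    -- Conjugation negates r and fixes 6j + 1 - 3r, so it acts by (r, j) ↦ (-r, j - r). At r = 0 the
    -- equation reads (6j + 1)² = 2n + 1, which is n = 12 `pentagonal j`.
    sparse-coefficient : ∀ {p} → HasParity InS p → HasParity (λ j → 12 ℕ.* pentagonal j ≡ n) p
    sparse-coefficient E = parity-cong
      (λ {j} (H , _) → cancel 2 (+ 1) (trans (sym (square j)) H))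
      (λ { {j} refl → square j , refl })
      (pullback {P = λ (r , j) → Reduced (r , j) × r ≡ + 0} {Q = λ j → Reduced (+ 0 , j) × + 0 ≡ + 0}
        (λ j → + 0 , j) (λ _ _ → cong proj₂) (λ H → H)
        (λ { {_ , j} (H , refl) → j , (H , refl) , refl })
        (parity-fold (λ (r , j) → - r , j - r) proj₁
          (λ (r , j) → cong₂ _,_ (ℤ.neg-involutive r) (involutive r j))
          (λ _ → refl)
          (λ { {r , j} H → trans (reflect r j) H })
          (transport correspondence E)))
      where
      involutive : ∀ r j → j - r - - r ≡ j
      involutive = solve-∀
      reflect : ∀ r j → (+ 6 * (j - r) + + 1 - + 3 * - r) * (+ 6 * (j - r) + + 1 - + 3 * - r) + + 7 * (- r * - r) ≡
                        (+ 6 * j + + 1 - + 3 * r) * (+ 6 * j + + 1 - + 3 * r) + + 7 * (r * r)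
      reflect = solve-∀
      square : ∀ j → reducedForm (+ 0) j ≡ + 2 * + (12 ℕ.* pentagonal j) + + 1
      square j = trans (step j) (trans (cong (λ a → + 12 * a + + 1) (sym (2*pentagonal j)))
        (trans (regroup (+ pentagonal j)) (cong (λ z → + 2 * z + + 1) (sym (ℤ.pos-* 12 (pentagonal j))))))
        where
        step : ∀ j → (+ 6 * j + + 1 - + 3 * + 0) * (+ 6 * j + + 1 - + 3 * + 0) + + 7 * (+ 0 * + 0) ≡
                     + 12 * (j * (+ 3 * j + + 1)) + + 1
        step = solve-∀
        regroup : ∀ a → + 12 * (+ 2 * a) + + 1 ≡ + 2 * (+ 12 * a) + + 1
        regroup = solve-∀

-- The prime 29 and the form 3y² + 8k².

module SqrtMinusSix where

  open Counting
  open import Data.Integer.Base using (ℤ; +_; _+_; _-_; _*_; -_; ∣_∣)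
  open import Data.Integer.Divisibility.Signed using (_∣_; divides; _∣?_; ∣ᵤ⇒∣; ∣⇒∣ᵤ)
  import Data.Integer.Properties as ℤ
  open import Data.Integer.Tactic.RingSolver using (solve-∀)
  open import Data.Nat.Base as ℕ using (ℕ)
  import Data.Nat.Divisibility as ℕ
  open import Data.Nat.Primality using (prime?; euclidsLemma)
  open import Data.Parity.Base using (0ℙ)
  open import Data.Parity.Properties using (p+p≡0ℙ)
  open import Data.Product.Base using (_×_; _,_; proj₁; proj₂)
  open import Data.Sum.Base as Sum using (_⊎_)
  open Integers
  open Pentagonal using (pentagonal)
  open import Relation.Binary.PropositionalEquality
    using (_≡_; refl; sym; trans; cong; cong₂; subst)
  open import Relation.Nullary using (¬_)
  open import Relation.Nullary.Decidable using (from-yes)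
  open Series
  open Theta

  abstract
    -- Normalised so that `12 form i l + 11` is 3(6i+1)² + 8(3l+1)². Being abstract, it is
    -- accessible below only through the identities of this block.
    form : ℤ → ℤ → ℤ
    form i l = + 3 * (i * (+ 3 * i + + 1)) + + 2 * (l * (+ 3 * l + + 2))

    form-value : ∀ i l → form i l ≡ + 2 * + (3 ℕ.* pentagonal i ℕ.+ octagonal l) + + 0
    form-value i l = trans
      (cong₂ (λ a b → + 3 * a + + 2 * b) (sym (2*pentagonal i)) (sym (pos-octagonal l)))
      (trans (regroup (+ pentagonal i) (+ octagonal l))
        (cong (λ z → + 2 * (z + + octagonal l) + + 0) (sym (ℤ.pos-* 3 (pentagonal i)))))
      where
      regroup : ∀ a b → + 3 * (+ 2 * a) + + 2 * b ≡ + 2 * (+ 3 * a + b) + + 0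
      regroup = solve-∀

    -- Put k = 3l + 1 and M = 6r + 5. For y = 29M - 6k, the value 3y² + 8k² is 116k(k - 9M) plus a
    -- multiple of M², hence symmetric under k ↦ 9M - k. A change of the sign of k afterwards gives
    -- k ↦ k - 9M, that is l ↦ l - 18r - 15, and now y = 29M + 6k.
    form-exchange : ∀ r l → let l′ = l - + 18 * r - + 15 in
                    form (+ 29 * r + + 23 - + 3 * l) l ≡ form (+ 29 * r + + 25 + + 3 * l′) l′
    form-exchange = step
      where
      step : ∀ r l → let l′ = l - + 18 * r - + 15; i = + 29 * r + + 23 - + 3 * l; i′ = + 29 * r + + 25 + + 3 * l′ in
             + 3 * (i * (+ 3 * i + + 1)) + + 2 * (l * (+ 3 * l + + 2)) ≡
             + 3 * (i′ * (+ 3 * i′ + + 1)) + + 2 * (l′ * (+ 3 * l′ + + 2))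
      step = solve-∀

    -- 12 form i l + 11 = 3y² + 8k² ≡ 3(y - 6k)(y + 6k) (mod 29) for y = 6i+1 and k = 3l+1.
    form-mod-29 : ∀ i l m → (i + + 3 * l - + 23) * (i - + 3 * l - + 25) ≡
      (+ 18 * m - (+ 67 * (i * i) + + 24 * i + + 45 * (l * l) + + 30 * l - + 13)) * + 29
      + + 18 * (+ 12 * form i l + + 11 - m * + 29)
    form-mod-29 = step
      where
      step : ∀ i l m → (i + + 3 * l - + 23) * (i - + 3 * l - + 25) ≡
        (+ 18 * m - (+ 67 * (i * i) + + 24 * i + + 45 * (l * l) + + 30 * l - + 13)) * + 29
        + + 18 * (+ 12 * (+ 3 * (i * (+ 3 * i + + 1)) + + 2 * (l * (+ 3 * l + + 2))) + + 11 - m * + 29)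
      step = solve-∀

    -- The squared terms are 6i + 1 = 3(a + b) + 145 and 2(3l + 1) = a - b. As 145 = 5 · 29, a
    -- common divisor 29 of a and b makes the value divisible by 29².
    form-factors : ∀ i l → let a = i + + 3 * l - + 23; b = i - + 3 * l - + 25 in
      + 12 * form i l + + 11 ≡
      + 3 * ((+ 3 * (a + b) + + 145) * (+ 3 * (a + b) + + 145)) + + 2 * ((a - b) * (a - b))
    form-factors = step
      where
      step : ∀ i l → let a = i + + 3 * l - + 23; b = i - + 3 * l - + 25 in
        + 12 * (+ 3 * (i * (+ 3 * i + + 1)) + + 2 * (l * (+ 3 * l + + 2))) + + 11 ≡
        + 3 * ((+ 3 * (a + b) + + 145) * (+ 3 * (a + b) + + 145)) + + 2 * ((a - b) * (a - b))
      step = solve-∀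

  module _ (N : ℕ) where

    Solution : ℤ × ℤ → Set
    Solution (i , l) = 3 ℕ.* pentagonal i ℕ.+ octagonal l ≡ N

    -- Solution (i , l) says 3y² + 8k² = 24N + 11 for y = 6i+1 and k = 3l+1. Minus says y ≡ -6k
    -- and Plus says y ≡ 6k (mod 29); multiplying y√-3 + 2k√2 by
    -- (√2 ± 3√-3)/(√2 ∓ 3√-3), which has norm 1, exchanges them.
    Minus Plus : ℤ × ℤ → Set
    Minus (i , l) = Solution (i , l) × + 29 ∣ i + + 3 * l - + 23
    Plus  (i , l) = Solution (i , l) × + 29 ∣ i - + 3 * l - + 25

    private
      form-solution : ∀ i l → Solution (i , l) → form i l ≡ + 2 * + N + + 0
      form-solution i l S = trans (form-value i l) (cong (λ z → + 2 * + z + + 0) S)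

      transfer : ∀ ((i , l) (i′ , l′) : ℤ × ℤ) → form i l ≡ form i′ l′ → Solution (i , l) → Solution (i′ , l′)
      transfer (i , l) (i′ , l′) same S =
        cancel 2 (+ 0) (trans (sym (form-value i′ l′)) (trans (sym same) (form-solution i l S)))

      minusPoint plusPoint shift : ℤ × ℤ → ℤ × ℤ
      minusPoint (r , l) = + 29 * r + + 23 - + 3 * l , l
      plusPoint  (r , l) = + 29 * r + + 25 + + 3 * l , l
      shift      (r , l) = r , l - + 18 * r - + 15

      -- The quotient r takes the place of the divisibility condition, so that the exchange of the
      -- two classes is linear in r and l, up to constants.
      minus⇒parametrised : ∀ {p} → HasParity Minus p → HasParity (λ x → Solution (minusPoint x)) p
      minus⇒parametrised = pullback minusPoint
        (λ { {r , l} {r′ , l′} _ _ e → same r r′ l l′ (cong proj₁ e) (cong proj₂ e) })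
        (λ { {r , l} S → S , divides r (exact r l) })
        (λ { {i , l} (S , divides r e) → (r , l) , subst Solution (sym (point r i l e)) S , point r i l e })
        where
        cancel-r : ∀ r r′ l → + 29 * r ≡ + 29 * r′ + + 1 * (+ 29 * r + + 23 - + 3 * l - (+ 29 * r′ + + 23 - + 3 * l))
        cancel-r = solve-∀
        same : ∀ r r′ l l′ → + 29 * r + + 23 - + 3 * l ≡ + 29 * r′ + + 23 - + 3 * l′ → l ≡ l′ → (r , l) ≡ (r′ , l′)
        same r r′ l _ e refl = cong (_, l) (ℤ.*-cancelˡ-≡ (+ 29) r r′ (combine (+ 1) e (cancel-r r r′ l)))
        exact : ∀ r l → + 29 * r + + 23 - + 3 * l + + 3 * l - + 23 ≡ r * + 29
        exact = solve-∀
        solve-i : ∀ r i l → + 29 * r + + 23 - + 3 * l ≡ i + - (+ 1) * (i + + 3 * l - + 23 - r * + 29)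
        solve-i = solve-∀
        point : ∀ r i l → i + + 3 * l - + 23 ≡ r * + 29 → minusPoint (r , l) ≡ (i , l)
        point r i l e = cong (_, l) (combine (- (+ 1)) e (solve-i r i l))

      parametrised⇒plus : ∀ {p} → HasParity (λ x → Solution (plusPoint x)) p → HasParity Plus p
      parametrised⇒plus = pushforward plusPoint
        (λ { {r , l} {r′ , l′} _ _ e → same r r′ l l′ (cong proj₁ e) (cong proj₂ e) })
        (λ { {r , l} S → S , divides r (exact r l) })
        (λ { {i , l} (S , divides r e) → (r , l) , subst Solution (sym (point r i l e)) S , point r i l e })
        where
        cancel-r : ∀ r r′ l → + 29 * r ≡ + 29 * r′ + + 1 * (+ 29 * r + + 25 + + 3 * l - (+ 29 * r′ + + 25 + + 3 * l))
        cancel-r = solve-∀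
        same : ∀ r r′ l l′ → + 29 * r + + 25 + + 3 * l ≡ + 29 * r′ + + 25 + + 3 * l′ → l ≡ l′ → (r , l) ≡ (r′ , l′)
        same r r′ l _ e refl = cong (_, l) (ℤ.*-cancelˡ-≡ (+ 29) r r′ (combine (+ 1) e (cancel-r r r′ l)))
        exact : ∀ r l → + 29 * r + + 25 + + 3 * l - + 3 * l - + 25 ≡ r * + 29
        exact = solve-∀
        solve-i : ∀ r i l → + 29 * r + + 25 + + 3 * l ≡ i + - (+ 1) * (i - + 3 * l - + 25 - r * + 29)
        solve-i = solve-∀
        point : ∀ r i l → i - + 3 * l - + 25 ≡ r * + 29 → plusPoint (r , l) ≡ (i , l)
        point r i l e = cong (_, l) (combine (- (+ 1)) e (solve-i r i l))

      exchange : ∀ {p} → HasParity (λ x → Solution (minusPoint x)) p → HasParity (λ x → Solution (plusPoint x)) p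
      exchange = pushforward shift
        (λ { {r , l} {r′ , l′} _ _ e → same r r′ l l′ (cong proj₁ e) (cong proj₂ e) })
        (λ { {r , l} → transfer (minusPoint (r , l)) (plusPoint (shift (r , l))) (form-exchange r l) })
        (λ { {r , l} S → (r , l + + 18 * r + + 15)
           , transfer (plusPoint (r , l)) (minusPoint (r , l + + 18 * r + + 15))
               (sym (trans (form-exchange r (l + + 18 * r + + 15))
                 (cong (λ z → form (+ 29 * r + + 25 + + 3 * z) z) (unshift r l)))) S
           , cong (r ,_) (unshift r l) })
        where
        cancel-l : ∀ r l l′ → l ≡ l′ + + 1 * (l - + 18 * r - + 15 - (l′ - + 18 * r - + 15))
        cancel-l = solve-∀
        same : ∀ r r′ l l′ → r ≡ r′ → l - + 18 * r - + 15 ≡ l′ - + 18 * r′ - + 15 → (r , l) ≡ (r′ , l′)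
        same r _ l l′ refl e = cong (r ,_) (combine (+ 1) e (cancel-l r l l′))
        unshift : ∀ r l → l + + 18 * r + + 15 - + 18 * r - + 15 ≡ l
        unshift = solve-∀

      norm-value : ∀ {i l} → Solution (i , l) → + 12 * form i l + + 11 ≡ + (24 ℕ.* N ℕ.+ 11)
      norm-value {i} {l} S = trans (cong (λ z → + 12 * z + + 11) (form-solution i l S))
        (trans (step (+ N)) (cong (_+ + 11) (sym (ℤ.pos-* 24 N))))
        where
        step : ∀ n → + 12 * (+ 2 * n + + 0) + + 11 ≡ + 24 * n + + 11
        step = solve-∀

      covering : 29 ℕ.∣ 24 ℕ.* N ℕ.+ 11 → ∀ {i l} → Solution (i , l) → Minus (i , l) ⊎ Plus (i , l)
      covering 29∣ {i} {l} S = Sum.map (λ d → S , ∣ᵤ⇒∣ d) (λ d → S , ∣ᵤ⇒∣ d)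
        (euclidsLemma ∣ i + + 3 * l - + 23 ∣ ∣ i - + 3 * l - + 25 ∣ (from-yes (prime? 29))
          (subst (29 ℕ.∣_) (ℤ.abs-* (i + + 3 * l - + 23) (i - + 3 * l - + 25)) (∣⇒∣ᵤ product)))
        where
        product : + 29 ∣ (i + + 3 * l - + 23) * (i - + 3 * l - + 25)
        product with divides m e ← ∣ᵤ⇒∣ {+ 29} {+ (24 ℕ.* N ℕ.+ 11)} 29∣ =
          divides (+ 18 * m - (+ 67 * (i * i) + + 24 * i + + 45 * (l * l) + + 30 * l - + 13))
            -- Modulo 29 the two factors are (y + 6k)/6 and (y - 6k)/6, so 24N + 11 is 108 times
            -- their product, and 18 inverts 108.
            (combine (+ 18) (trans (norm-value {i} {l} S) e) (form-mod-29 i l m))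

      exclusive : ¬ 841 ℕ.∣ 24 ℕ.* N ℕ.+ 11 → ∀ {x} → Minus x → ¬ Plus x
      exclusive 841∤ {i , l} (S , divides x e) (_ , divides y e′) = 841∤ (∣⇒∣ᵤ {+ 841}
        (divides
        (+ 3 * ((+ 3 * (x + y) + + 5) * (+ 3 * (x + y) + + 5)) + + 2 * ((x - y) * (x - y)))
        (trans (sym (norm-value {i} {l} S)) (trans (form-factors i l)
          (trans (cong₂ (λ a b → + 3 * ((+ 3 * (a + b) + + 145) * (+ 3 * (a + b) + + 145)) + + 2 * ((a - b) * (a - b))) e e′)
            (factor x y))))))
        where
        factor : ∀ x y → + 3 * ((+ 3 * (x * + 29 + y * + 29) + + 145) * (+ 3 * (x * + 29 + y * + 29) + + 145))
                   + + 2 * ((x * + 29 - y * + 29) * (x * + 29 - y * + 29)) ≡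
                 (+ 3 * ((+ 3 * (x + y) + + 5) * (+ 3 * (x + y) + + 5)) + + 2 * ((x - y) * (x - y))) * + 841
        factor = solve-∀

    -- Divisibility by 29 puts each solution into one of the two classes, the absence of 29² keeps
    -- the classes disjoint, and the exchange gives them the same parity p; the total is p + p.
    vanishing : 29 ℕ.∣ 24 ℕ.* N ℕ.+ 11 → ¬ 841 ℕ.∣ 24 ℕ.* N ℕ.+ 11 →
                ∀ {f g} → Graded f (λ i → 3 ℕ.* pentagonal i) → Graded g octagonal → (f ⊛ g) N ≡ 0ℙ
    vanishing 29∣ 841∤ F G
      with p , E ← parity-filter (λ (i , l) → + 29 ∣? i + + 3 * l - + 23) (graded-⊛ F G N) =
      trans (parity-unique (graded-⊛ F G N)
        (parity-union E (parametrised⇒plus (exchange (minus⇒parametrised E))) 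
          (λ {x} → exclusive 841∤ {x}) (λ { {i , l} → covering 29∣ {i} {l} }) proj₁ proj₁))
      (p+p≡0ℙ p)

-- Assembly of the series identities.

module GeneratingFunctions where

  open import Algebra.Bundles using (CommutativeRing)
  open Counting
  open import Data.Nat.Divisibility using (_∣_; _∣?_; divides; ∣m+n∣m⇒∣n)
  open import Data.Nat.Base using (zero; suc; NonZero; >-nonZero; z<s; _≤_)
  import Data.Nat.Properties as ℕ
  open import Data.Nat.Tactic.RingSolver using (solve-∀)
  open import Data.Parity.Base as ℙ using (0ℙ)
  import Data.Parity.Properties as ℙ
  open import Data.Integer.Base using (ℤ; +_; -[1+_]; ∣_∣)
  open import Data.Product.Base using (_,_)
  open import Function.Base using (_∘_)
  open Integers
  open Partitions
  open Pentagonal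
  open PentagonalProducts
  open import Relation.Binary.PropositionalEquality
    using (_≡_; refl; sym; trans; cong; cong₂)
  open import Relation.Nullary using (¬_; ¬?)
  open import Relation.Nullary.Decidable using (from-yes)
  open Series
  open Solver using (solve; _:*_; _:=_)
  open SqrtMinusSeven
  open SqrtMinusSix
  open Theta
  open import Defs
  open import Data.Nat.Base using (ℕ; _+_; _*_)

  private
    module R = CommutativeRing seriesRing
    open import Relation.Binary.Reasoning.Setoid R.setoid

  theta-multiple : ∀ k .{{_ : NonZero k}} (a : ℤ → ℕ) → (∀ i → ∣ i ∣ ≤ a i) →
                   Graded (theta (λ i → k * a i)) (λ i → k * a i)
  theta-multiple k a ∣i∣≤a = theta-graded (λ i → ℕ.≤-trans (∣i∣≤a i) (ℕ.m≤n*m (a i) k))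

  ∣i∣≤octagonal : ∀ i → ∣ i ∣ ≤ octagonal i
  ∣i∣≤octagonal (+ n)    = ℕ.m≤m*n n (3 * n + 2) {{>-nonZero (ℕ.<-≤-trans z<s (ℕ.m≤n+m 2 (3 * n)))}}
  ∣i∣≤octagonal -[1+ n ] = ℕ.m≤m*n (suc n) (3 * n + 1) {{>-nonZero (ℕ.m≤n+m 1 (3 * n))}}

  f₁ f₃ f₂₁ ψ b₂₁ c : Series
  f₁  = theta pentagonal
  f₃  = theta (λ i → 3 * pentagonal i)
  f₂₁ = theta (λ i → 21 * pentagonal i)
  ψ   = theta octagonal
  b₂₁ = regularSeries 21
  c n = b₂₁ (4 * n + 1)

  F₁ : Graded f₁ pentagonal
  F₁ = theta-graded ∣i∣≤pentagonal

  F₃ : Graded f₃ (λ i → 3 * pentagonal i)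
  F₃ = theta-multiple 3 pentagonal ∣i∣≤pentagonal

  F₂₁ : Graded f₂₁ (λ i → 21 * pentagonal i)
  F₂₁ = theta-multiple 21 pentagonal ∣i∣≤pentagonal

  Ψ : Graded ψ octagonal
  Ψ = theta-graded ∣i∣≤octagonal

  fourth : ∀ f (a : ℤ → ℕ) → Graded f a → Graded ((f ⊛ f) ⊛ (f ⊛ f)) (λ i → 4 * a i)
  fourth f a F = graded-cong (λ i → sym (ℕ.*-assoc 2 2 (a i))) (graded-square {f ⊛ f} {λ i → 2 * a i} (graded-square {f} {a} F))

  -- The hypotheses say that f⁴ is f(q⁴).
  dissection : ∀ {f f⁴} g → (∀ n → f⁴ (4 * n) ≡ f n) → (∀ {n} → ¬ 4 ∣ n → f⁴ n ≡ 0ℙ) →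
               ∀ n → (f⁴ ⊛ g) (4 * n + 1) ≡ (f ⊛ (λ m → g (4 * m + 1))) n
  dissection {f} {f⁴} g f⁴-at f⁴-off zero = trans
    (cong₂ (λ x y → (x ℙ.* g 1) ℙ.+ (y ℙ.* g 0)) (f⁴-at 0) (f⁴-off (from-yes (¬? (4 ∣? 1)))))
    (ℙ.+-identityʳ _)
  dissection {f} {f⁴} g f⁴-at f⁴-off (suc n) = trans
    (cong (f⁴ ⊛ g) (index n))
    (step (f⁴-at 0) (f⁴-off (from-yes (¬? (4 ∣? 1)))) (f⁴-off (from-yes (¬? (4 ∣? 2)))) (f⁴-off (from-yes (¬? (4 ∣? 3))))
      (cong g (sym (index n)))
      (dissection {f ∘ suc} {λ m → f⁴ (4 + m)} g
        (λ m → trans (cong f⁴ (sym (ℕ.*-suc 4 m))) (f⁴-at (suc m)))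
        (λ 4∤m → f⁴-off (λ 4∣4+m → 4∤m (∣m+n∣m⇒∣n 4∣4+m (divides 1 refl)))) n))
    where
    index : ∀ n → 4 * suc n + 1 ≡ 4 + (4 * n + 1)
    index = solve-∀
    step : ∀ {a b c d x x′ y y′ v₁ v₂ v₃ v₄} → a ≡ x → b ≡ 0ℙ → c ≡ 0ℙ → d ≡ 0ℙ → v₁ ≡ x′ → y ≡ y′ →
           (a ℙ.* v₁) ℙ.+ ((b ℙ.* v₂) ℙ.+ ((c ℙ.* v₃) ℙ.+ ((d ℙ.* v₄) ℙ.+ y))) ≡ (x ℙ.* x′) ℙ.+ y′
    step refl refl refl refl refl refl = refl

  f₁⁴ f₃⁴ : Series
  f₁⁴ = (f₁ ⊛ f₁) ⊛ (f₁ ⊛ f₁)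
  f₃⁴ = (f₃ ⊛ f₃) ⊛ (f₃ ⊛ f₃)

  F₁⁴ : Graded f₁⁴ (λ i → 4 * pentagonal i)
  F₁⁴ = fourth f₁ pentagonal F₁

  F₃⁴ : Graded f₃⁴ (λ i → 12 * pentagonal i)
  F₃⁴ = graded-cong (λ i → sym (ℕ.*-assoc 4 3 (pentagonal i))) (fourth f₃ (λ i → 3 * pentagonal i) F₃)

  -- Of the four copies of f₁ that multiply the series b₂₁, one turns it into f₂₁. Taken together
  -- they form f₁(q⁴), which leaves the extraction of exponents 4n + 1 as f₁.
  f₁⊛c≈f₃⁴ : f₁ ⊛ c ≈ f₃⁴
  f₁⊛c≈f₃⁴ n = trans
    (sym (dissection {f₁} {f₁⁴} b₂₁ 
      (graded-multiple {a = pentagonal} 4 F₁ F₁⁴) (graded-nonmultiple {a = pentagonal} 4 F₁⁴) n))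
    (trans (cubed (4 * n + 1))
    (parity-unique
      (sparse-coefficient n (graded-⊛ (pentagonal-cube F₁) F₂₁ (4 * n + 1)))
      (F₃⁴ n)))
    where
    cubed : f₁⁴ ⊛ b₂₁ ≈ (f₁ ⊛ (f₁ ⊛ f₁)) ⊛ f₂₁
    cubed = begin
      f₁⁴ ⊛ b₂₁                       ≈⟨ solve 2 (λ x y → ((x :* x) :* (x :* x)) :* y := (x :* (x :* x)) :* (y :* x))
                                          R.refl f₁ b₂₁ ⟩
      (f₁ ⊛ (f₁ ⊛ f₁)) ⊛ (b₂₁ ⊛ f₁)   ≈⟨ R.*-congˡ {f₁ ⊛ (f₁ ⊛ f₁)} (regular-⊛-pentagonal 21 F₁ F₂₁) ⟩
      (f₁ ⊛ (f₁ ⊛ f₁)) ⊛ f₂₁          ∎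

  -- Both sides generate `3 * triangularℤ u`: the left by the descent in ℤ[√-2], the right as the
  -- image of f₁³ under q ↦ q³.
  f₁⊛ψ≈f₃³ : f₁ ⊛ ψ ≈ f₃ ⊛ (f₃ ⊛ f₃)
  f₁⊛ψ≈f₃³ = graded-unique (pentagonal-⊛-octagonal F₁ Ψ)
    (graded-scale 3 (graded-⊛ F₁ (graded-square F₁)) (pentagonal-cube F₁)
      (graded-cong (λ (x , y) → regroup (pentagonal x) (pentagonal y)) (graded-⊛ F₃ (graded-square F₃))))
    where
    regroup : ∀ a b → 3 * a + 2 * (3 * b) ≡ 3 * (a + 2 * b)
    regroup = solve-∀

  c≈f₃⊛ψ : c ≈ f₃ ⊛ ψ
  -- Here `refl` evaluates the constant term of f₁ to 1.
  c≈f₃⊛ψ = ⊛-cancelʳ {c} {f₃ ⊛ ψ} f₁ refl (begin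
    c ⊛ f₁                 ≈⟨ R.*-comm c f₁ ⟩
    f₁ ⊛ c                 ≈⟨ f₁⊛c≈f₃⁴ ⟩
    f₃⁴                    ≈⟨ solve 1 (λ x → (x :* x) :* (x :* x) := x :* (x :* (x :* x))) R.refl f₃ ⟩
    f₃ ⊛ (f₃ ⊛ (f₃ ⊛ f₃))  ≈⟨ R.*-congˡ {f₃} f₁⊛ψ≈f₃³ ⟨
    f₃ ⊛ (f₁ ⊛ ψ)          ≈⟨ solve 3 (λ x y z → x :* (y :* z) := (x :* z) :* y) R.refl f₃ f₁ ψ ⟩
    (f₃ ⊛ ψ) ⊛ f₁          ∎)

-- The residues β and the valuation of 24β + 11 at 29.

open import Data.List.Relation.Unary.All as All using (All; all?)
open import Data.Nat.Base using (suc; parity)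
open import Data.Nat.Divisibility using (_∣?_; divides; ∣m+n∣m⇒∣n; ∣m∣n⇒∣m+n; ∣-trans; m∣m*n)
open import Data.Nat.Tactic.RingSolver using (solve-∀)
open import Data.Parity.Base using (0ℙ)
open import Data.Product.Base using (_×_; proj₁; proj₂)
open import Function.Base using (_∘_)
open import Relation.Binary.PropositionalEquality using (_≡_; refl; sym; trans; subst)
open import Relation.Nullary using (¬_; ¬?; _×-dec_)
open import Relation.Nullary.Decidable using (from-yes)
open import Defs
open import Data.List.Base using (List; []; _∷_)
open import Data.List.Membership.Propositional using (_∈_)
open import Data.Nat.Base using (ℕ; _+_; _*_; _^_)
open import Data.Nat.Divisibility using (_∣_)
open GeneratingFunctions using (c≈f₃⊛ψ; F₃; Ψ)
open SqrtMinusSix using (vanishing)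

parity-even : ∀ m → parity m ≡ 0ℙ → 2 ∣ m
parity-even 0             _ = divides 0 refl
parity-even (suc (suc m)) e = ∣m∣n⇒∣m+n (divides 1 refl) (parity-even m e)

βs : List ℕ
βs = 8 ∷ 37 ∷ 66 ∷ 95 ∷ 124 ∷ 153 ∷ 182 ∷ 211 ∷ 240 ∷ 269 ∷ 298 ∷ 327 ∷ 356 ∷
     414 ∷ 443 ∷ 472 ∷ 501 ∷ 530 ∷ 559 ∷ 588 ∷ 617 ∷ 646 ∷ 675 ∷ 704 ∷ 733 ∷
     762 ∷ 791 ∷ 820 ∷ []

-- Since 24 · 8 + 11 = 7 · 29, the candidates are β = 8 + 29j with 0 ≤ j ≤ 28. The value 385, at j =
-- 13, is absent because 24 · 385 + 11 = 11 · 29².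
βs-valuation : All (λ β → (29 ∣ 24 * β + 11) × ¬ (29 ^ 2 ∣ 24 * β + 11)) βs
βs-valuation = from-yes (all? (λ β → 29 ∣? 24 * β + 11 ×-dec ¬? (29 ^ 2 ∣? 24 * β + 11)) βs)

b₂₁-even : ∀ N → 29 ∣ 24 * N + 11 → ¬ 29 ^ 2 ∣ 24 * N + 11 → 2 ∣ b 21 (4 * N + 1)
b₂₁-even N 29∣ 29²∤ = parity-even (b 21 (4 * N + 1)) (trans (c≈f₃⊛ψ N) (vanishing N 29∣ 29²∤ F₃ Ψ))

module _ (k n β : ℕ) where

  expand : 24 * (k * n + β) + 11 ≡ k * (24 * n) + (24 * β + 11)
  expand = distribute k n β
    where
    distribute : ∀ k n β → 24 * (k * n + β) + 11 ≡ k * (24 * n) + (24 * β + 11)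
    distribute = solve-∀

  ∣-shift : ∀ {d} → d ∣ k → d ∣ 24 * β + 11 → d ∣ 24 * (k * n + β) + 11
  ∣-shift {d} d∣k d∣ = subst (d ∣_) (sym expand) (∣m∣n⇒∣m+n (∣-trans d∣k (m∣m*n (24 * n))) d∣)

  ∣-unshift : k ∣ 24 * (k * n + β) + 11 → k ∣ 24 * β + 11
  ∣-unshift k∣ = ∣m+n∣m⇒∣n (subst (k ∣_) expand k∣) (m∣m*n (24 * n))

theorem1p4 : ∀ (β : ℕ) →
    β ∈ (8 ∷ 37 ∷ 66 ∷ 95 ∷ 124 ∷ 153 ∷ 182 ∷ 211 ∷ 240 ∷ 269 ∷ 298 ∷ 327 ∷ 356 ∷
    414 ∷ 443 ∷ 472 ∷ 501 ∷ 530 ∷ 559 ∷ 588 ∷ 617 ∷ 646 ∷ 675 ∷ 704 ∷ 733 ∷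
    762 ∷ 791 ∷ 820 ∷ []) →
    ∀ (n : ℕ) → 2 ∣ b 21 (4 * (29 ^ 2 * n + β) + 1)
theorem1p4 β β∈ n = b₂₁-even (29 ^ 2 * n + β)
  (∣-shift (29 ^ 2) n β (divides 29 refl) (proj₁ valuation))
  (proj₂ valuation ∘ ∣-unshift (29 ^ 2) n β)
  where
  valuation : (29 ∣ 24 * β + 11) × ¬ (29 ^ 2 ∣ 24 * β + 11)
  valuation = All.lookup βs-valuation β∈
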